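{- Let $G$ be a finite abelian group. Then $\delta(G)\le (2|G|)^{3|G|+1}$.
   Context: $G$ is written additively. A sequence over $G$ is a finite unordered list of elements of $G$ with repetitions (an element of the free abelian monoid $\mathcal{F}(G)$). A zero-sum sequence has sum $0$; a minimal zero-sum sequence is a non-empty zero-sum sequence with no proper non-empty zero-sum subsequence; $\mathcal{A}(G)$ is the set of these. Factorizations are elements of the free abelian monoid $\mathsf{Z}(G)$ over $\mathcal{A}(G)$ (formal unordered products of minimal zero-sum sequences); $\pi:\mathsf{Z}(G)\to\mathcal{F}(G)$ evaluates the product; $|\zeta|$ is the number of factors (with multiplicity); for a zero-sum sequence $B$, $\mathsf{L}(B)=\{|\zeta|: \pi(\zeta)=B\}$. For $\zeta,\xi\in\mathsf{Z}(G)$, $\mathsf{d}(\zeta,\xi)=\max\{|\gcd(\zeta,\xi)^{ -1}\zeta|,|\gcd(\zeta,\xi)^{ -1}\xi|\}$. Two distinct $k,\ell\in\mathsf{L}(B)$ are adjacent lengths of $B$ if no element of $\mathsf{L}(B)$ lies strictly between them. For $\zeta\in\mathsf{Z}(G)$, $\delta(\zeta)$ is the smallest $m\in\mathbb{N}_0$ such that whenever $k\in\mathbb{N}$ and $k$, $|\zeta|$ are adjacent lengths of $\pi(\zeta)$, there is $\xi\in\mathsf{Z}(G)$ with $\pi(\xi)=\pi(\zeta)$, $|\xi|=k$ and $\mathsf{d}(\xi,\zeta)\le m$. The successive distance is $\delta(G)=\sup\{\delta(\zeta):\zeta\in\mathsf{Z}(G)\}$. -}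

module Defs where

open import Algebra.Bundles using (AbelianGroup; CommutativeMonoid)
import Algebra.Definitions.RawMagma as RawMagmaDefs
open import Data.Fin.Base using (Fin)
open import Data.List.Base using (List; []; _++_; concat; foldr; length; map)
import Data.List.Relation.Binary.Permutation.Setoid as Perm
import Data.List.Relation.Binary.Permutation.Setoid.Properties as PermProps
open import Data.Nat.Base using (ℕ; _≤_; _<_; _⊔_)
open import Data.Product.Base using (∃-syntax; Σ; _×_; proj₁)
open import Data.Sum.Base using (_⊎_)
open import Function.Bundles using (Inverse)
open import Level using () renaming (_⊔_ to _⊔ˡ_)
open import Relation.Binary.Bundles using (Setoid)
import Relation.Binary.Construct.On as On
open import Relation.Binary.PropositionalEquality.Core using (_≡_; _≢_)
open import Relation.Binary.PropositionalEquality.Properties using () renaming (setoid to ≡-setoid)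
open import Relation.Nullary.Negation.Core using (¬_)

HasOrder : ∀ {c ℓ} → AbelianGroup c ℓ → ℕ → Set (c ⊔ˡ ℓ)
HasOrder G n = Inverse (AbelianGroup.setoid G) (≡-setoid (Fin n))

-- The free abelian monoid over a setoid S: lists, equal up to permutation (and
-- up to the equality of S), under concatenation.
module FreeAbelianMonoid {a ℓ} (S : Setoid a ℓ) where

  open Setoid S using () renaming (Carrier to A)
  open Perm S using (_↭_) public
  open RawMagmaDefs (CommutativeMonoid.rawMagma (PermProps.++-commutativeMonoid S)) using (_∣ˡ_)

  infix 4 _∣_

  _∣_ : List A → List A → Set (a ⊔ˡ ℓ)
  _∣_ = _∣ˡ_

  record IsGCD (g x y : List A) : Set (a ⊔ˡ ℓ) where
    field
      divides₁ : g ∣ x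
      divides₂ : g ∣ y
      greatest : ∀ h → h ∣ x → h ∣ y → h ∣ g

  -- m = max { |g⁻¹x| , |g⁻¹y| } with g = gcd(x, y); the quotients x′ and y′ are
  -- unique up to ↭ because the monoid is cancellative.
  record IsDistance (x y : List A) (m : ℕ) : Set (a ⊔ˡ ℓ) where
    field
      g x′ y′ : List A
      isGCD   : IsGCD g x y
      x≈gx′   : x ↭ g ++ x′
      y≈gy′   : y ↭ g ++ y′
      m≡max   : m ≡ length x′ ⊔ length y′

module ZeroSum {c ℓ} (G : AbelianGroup c ℓ) where

  open AbelianGroup G using (Carrier; _≈_; _∙_; ε; setoid)

  module F = FreeAbelianMonoid setoid

  Sequence : Set c
  Sequence = List Carrier

  σ : Sequence → Carrier
  σ = foldr _∙_ ε

  IsZeroSum : Sequence → Set ℓ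
  IsZeroSum S = σ S ≈ ε

  record IsMinimalZeroSum (S : Sequence) : Set (c ⊔ˡ ℓ) where
    field
      nonEmpty : S ≢ []
      zeroSum  : IsZeroSum S
      minimal  : ¬ (∃[ T ] T F.∣ S × ¬ (T F.↭ S) × T ≢ [] × IsZeroSum T)

  Atom : Set (c ⊔ˡ ℓ)
  Atom = Σ Sequence IsMinimalZeroSum

  atomSetoid : Setoid (c ⊔ˡ ℓ) (c ⊔ˡ ℓ)
  atomSetoid = On.setoid (Perm.↭-setoid setoid) (proj₁ {B = IsMinimalZeroSum})

  module Z = FreeAbelianMonoid atomSetoid

  Factorization : Set (c ⊔ˡ ℓ)
  Factorization = List Atom

  π : Factorization → Sequence
  π ζ = concat (map proj₁ ζ)

  infix 4 _∈L_

  _∈L_ : ℕ → Sequence → Set (c ⊔ˡ ℓ)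
  k ∈L B = ∃[ ζ ] π ζ F.↭ B × length ζ ≡ k

  StrictlyBetween : ℕ → ℕ → ℕ → Set
  StrictlyBetween k l j = (k < j × j < l) ⊎ (l < j × j < k)

  record AdjacentLengths (B : Sequence) (k l : ℕ) : Set (c ⊔ˡ ℓ) where
    field
      k∈L      : k ∈L B
      l∈L      : l ∈L B
      distinct : k ≢ l
      adjacent : ∀ j → j ∈L B → ¬ StrictlyBetween k l j

  d[_,_]≤_ : Factorization → Factorization → ℕ → Set (c ⊔ˡ ℓ)
  d[ ξ , ζ ]≤ m = ∃[ n ] Z.IsDistance ξ ζ n × n ≤ m

  ReachesAdjacent : Factorization → ℕ → Set (c ⊔ˡ ℓ)
  ReachesAdjacent ζ m =
    ∀ k → 1 ≤ k → AdjacentLengths (π ζ) k (length ζ) →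
    ∃[ ξ ] π ξ F.↭ π ζ × length ξ ≡ k × d[ ξ , ζ ]≤ m

  -- δ(ζ) = m
  record Isδ (ζ : Factorization) (m : ℕ) : Set (c ⊔ˡ ℓ) where
    field
      reaches : ReachesAdjacent ζ m
      least   : ∀ m′ → ReachesAdjacent ζ m′ → m ≤ m′

  -- δ(G) ≤ N.  The supremum of the δ(ζ) is taken in ℕ ∪ {∞}, where it is at most
  -- N exactly when N is an upper bound; that each δ(ζ) exists is part of the claim,
  -- so that the bound cannot hold for lack of values.
  SuccessiveDistance≤ : ℕ → Set (c ⊔ˡ ℓ)
  SuccessiveDistance≤ N = ∀ ζ → ∃[ m ] Isδ ζ m × m ≤ N

{-# OPTIONS --safe #-}
-- Let k and |ζ| be adjacent lengths, ξ a factorization of length k of the same sequence,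
-- and s = | k - |ζ| |. Every atom has length at most n = |G|, so the atoms of ζ and ξ, with
-- opposite signs, give vectors in [-n, n]^(n+1) (multiplicities and length); s further
-- vectors for the difference of the lengths make their sum 0. By the Steinitz lemma the
-- vectors can be ordered so that all partial sums stay in a box of at most (2n)^(2n+2)
-- points, so if there are more vectors than this, two partial sums coincide and the
-- family splits into two nonempty zero-sum families. Each of them exchanges a part of ζ
-- for a part of ξ and changes the length by its number of extra vectors, which by
-- adjacency is 0 or s. Keeping the part with s of them and iterating leaves an exchange
-- of bounded size. The count of points needs n ≥ 2; for n = 1 all factorizations of a
-- sequence have the same length.
module Submission where

open import Defs
open import Algebra.Bundles using (AbelianGroup; CommutativeMonoid)
import Algebra.Definitions.RawMagma as RawMagmaDefs
open import Data.Fin.Base using (Fin; zero; suc; finToFun; fromℕ<; funToFin; punchIn; toℕ)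
import Data.Fin.Properties as Fin
import Data.Integer.Base as ℤ
import Data.Integer.Properties as ℤ
import Data.Integer.Tactic.RingSolver as ℤ-Solver
open import Data.List.Base
  using (List; []; _∷_; _++_; drop; length; lookup; map; mapMaybe; replicate; tabulate; take)
open import Data.List.Properties
  using ( ++-assoc; ++-conicalʳ; ++-identityʳ; length-++; length-drop; length-mapMaybe; length-replicate
        ; length-tabulate; mapMaybe-++; mapMaybe-map-none; mapMaybe-map-retract; tabulate-lookup; take++drop≡id )
open import Data.List.Relation.Binary.Pointwise.Base using (Pointwise; []; _∷_)
open import Data.List.Relation.Unary.Any using (here; there)
open import Data.Maybe.Base using (Maybe; just; nothing)
open import Data.Nat.Base using (ℕ; zero; suc)
import Data.Nat.Base as ℕ
open import Data.Nat.Induction using (<-wellFounded)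
import Data.Nat.Properties as ℕ
open import Data.Nat.Tactic.RingSolver using (solve-∀)
open import Data.Product.Base using (∃-syntax; Σ-syntax; _×_; _,_; proj₁; proj₂)
open import Data.Sum.Base using (_⊎_; inj₁; inj₂; [_,_]′)
open import Data.Unit.Base using (⊤; tt)
open import Function.Base using (_∘_)
open import Function.Bundles using (Inverse)
open import Induction.WellFounded using (Acc; acc)
open import Level using (Level) renaming (_⊔_ to _⊔ˡ_)
open import Relation.Binary.Bundles using (DecSetoid; Setoid)
open import Relation.Binary.Definitions using (Decidable; _Respects_; tri<; tri≈; tri>)
open import Relation.Binary.PropositionalEquality as ≡
  using (_≡_; _≢_; cong; cong₂; subst; subst₂; module ≡-Reasoning)
open import Relation.Nullary using (¬_; Dec; yes; no; contradiction; ¬?)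
open import Relation.Nullary.Decidable using (decidable-stable; map′; _⊎-dec_; _×-dec_; _→-dec_)
open import Relation.Unary using (Pred) renaming (Decidable to Decidable₁)

-- The length difference s enters as s unit vectors, not as one vector with entry -s, because s is
-- not bounded beforehand: all entries must stay within n for the box to be independent of the two
-- factorizations.
--
-- The Steinitz lemma, with radius dimension d times entry bound, is proved by the method of
-- Grinberg and Sevastyanov. Vectors are removed one at a time, and those that remain carry weights
-- in [0, 1] with weighted sum 0 and total equal to their number minus d. Only d units of weight are
-- missing, so their plain sum is within d times the entry bound. The weights share one denominator,
-- which keeps the linear algebra in the integers.
--
-- The theorem also asserts that each δ(ζ) exists. Constructively a least value has to be searched
-- for, so reachability must be decidable; this rests on the bijection of G with `Fin n`, on lengths
-- being bounded by the length of the sequence, and on a list having finitely many divisors up to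
-- permutation.

split-at-drops : ∀ {a} {X : Set a} k l (xs : List X) → k ℕ.< l → l ℕ.< length xs →
  ∃[ ys ] ∃[ zs ] ∃[ ws ] xs ≡ ys ++ zs ++ ws × zs ≢ [] × ws ≢ [] ×
    drop k xs ≡ zs ++ ws × drop l xs ≡ ws
split-at-drops zero (suc l) (x ∷ xs) _ l<n =
  [] , x ∷ take l xs , drop l xs , whole , (λ ()) , nonempty l xs (ℕ.s≤s⁻¹ l<n) , whole , ≡.refl
  where
  whole = cong (x ∷_) (≡.sym (take++drop≡id l xs))
  nonempty : ∀ l xs → l ℕ.< length xs → drop l xs ≢ []
  nonempty zero    (_ ∷ _)  _   ()
  nonempty (suc l) (_ ∷ xs) l<n = nonempty l xs (ℕ.s≤s⁻¹ l<n)
split-at-drops (suc k) (suc l) (x ∷ xs) k<l l<n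
  with ys , zs , ws , eq , rest ← split-at-drops k l xs (ℕ.s≤s⁻¹ k<l) (ℕ.s≤s⁻¹ l<n)
  = x ∷ ys , zs , ws , cong (x ∷_) eq , rest

-- Fractional weights on vectors, and driving one of them to zero.

module Weightings where

  open import Algebra.Properties.AbelianGroup ℤ.+-0-abelianGroup using (∙-cancelˡ)
  open import Algebra.Properties.Semiring.Sum ℤ.+-*-semiring
  open import Data.Fin.Properties using (any?)
  open import Data.Integer.Base hiding (suc)
  open import Data.Integer.Properties
  open import Data.List.Base using (allFin; filter)
  open import Data.List.Membership.Propositional.Properties using (∈-allFin; ∈-filter⁺)
  import Data.List.Relation.Unary.All as All
  open import Data.List.Relation.Unary.All.Properties using (all-filter)
  open import Data.Rational.Unnormalised.Base using (ℚᵘ; mkℚᵘ) renaming (_≤_ to _≤ᵘ_)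
  open import Data.Rational.Unnormalised.Properties using () renaming (≤-totalOrder to ≤ᵘ-totalOrder; drop-*≤* to drop-≤ᵘ)
  open import Data.List.Extrema ≤ᵘ-totalOrder using (argmin; argmin-all; f[argmin]≤f[xs])
  open import Data.Vec.Functional using (insertAt; removeAt)
  open import Data.Vec.Functional.Properties using (insertAt-lookup; insertAt-punchIn)
  open ≡ using (refl; sym; trans)

  sum-linear : ∀ {f} a b (u w : Fin f → ℤ) →
    sum (λ j → a * u j + b * w j) ≡ a * sum u + b * sum w
  sum-linear a b u w = trans (∑-distrib-+ (λ j → a * u j) (λ j → b * w j))
    (cong₂ _+_ (sym (*-distribˡ-sum a u)) (sym (*-distribˡ-sum b w)))

  sum-const : ∀ f a → sum {f} (λ _ → a) ≡ + f * a
  sum-const zero    a = sym (*-zeroˡ a)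
  sum-const (suc f) a = trans (cong (λ z → a + z) (sum-const f a)) (sym (suc-* (+ f) a))

  sum-mono-≤ : ∀ {f} {u w : Fin f → ℤ} → (∀ j → u j ≤ w j) → sum u ≤ sum w
  sum-mono-≤ {zero}  u≤w = ≤-refl
  sum-mono-≤ {suc f} u≤w = +-mono-≤ (u≤w zero) (sum-mono-≤ (u≤w ∘ suc))

  sum-insertAt : ∀ {f} (w : Fin f → ℤ) p x (B : Fin (suc f) → ℤ) →
    sum (λ j → insertAt w p x j * B j) ≡ x * B p + sum (λ j → w j * B (punchIn p j))
  sum-insertAt w p x B = trans (sum-remove {i = p} (λ j → insertAt w p x j * B j))
    (cong₂ _+_ (cong (_* B p) (insertAt-lookup w p x))
      (sum-cong-≗ (λ j → cong (_* B (punchIn p j)) (insertAt-punchIn w p x j))))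

  insertAt-all : ∀ {f ℓ} (P : ℤ → Set ℓ) (w : Fin f → ℤ) p x →
    P x → (∀ j → P (w j)) → ∀ j → P (insertAt w p x j)
  insertAt-all         P w zero    x Px Pw zero    = Px
  insertAt-all         P w zero    x Px Pw (suc j) = Pw j
  insertAt-all {suc f} P w (suc p) x Px Pw zero    = Pw zero
  insertAt-all {suc f} P w (suc p) x Px Pw (suc j) =
    insertAt-all P (w ∘ suc) p x Px (Pw ∘ suc) j

  -- Fraction-free elimination: column `p` is cleared by multiplying the other rows by the pivot `a`
  -- instead of dividing by it, so the nonzero solution stays integral.
  kernel : ∀ {r f} (A : Fin r → Fin f → ℤ) → r ℕ.< f →
    Σ[ κ ∈ (Fin f → ℤ) ] (∃[ j ] κ j ≢ 0ℤ) × (∀ i → sum (λ j → κ j * A i j) ≡ 0ℤ)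
  kernel {zero}  {suc f} A _ = (λ _ → 1ℤ) , (zero , λ ()) , λ ()
  kernel {suc r} {suc f} A (ℕ.s≤s r<f) with any? (λ j → ¬? (A zero j ≟ 0ℤ))
  ... | no all-zero = κ , κ≢0 , λ where
      zero → trans (sum-cong-≗ (λ j → trans
               (cong (κ j *_) (decidable-stable (A zero j ≟ 0ℤ) (λ A≢0 → all-zero (j , A≢0))))
               (*-zeroʳ (κ j))))
             (sum-replicate-zero (suc f))
      (suc i) → vanishes i
    where
    rest = kernel (A ∘ suc) (ℕ.m<n⇒m<1+n r<f)
    κ = proj₁ rest
    κ≢0 = proj₁ (proj₂ rest)
    vanishes = proj₂ (proj₂ rest)
  -- Scaling the reduced solution by `a` lets the entry at `p` be `- t`: the pivot row then sums to
  -- `- t * a + a * t`.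
  ... | yes (p , a≢0) = insertAt (λ j → a * κ j) p (- t) , (punchIn p j₀ , κ′≢0) , λ where
      zero → trans (expand (A zero)) (cancel t a)
      (suc i) → trans (expand (A (suc i))) (trans (sym (eliminated i)) (vanishes i))
    where
    a = A zero p
    cancel : ∀ t a → - t * a + a * t ≡ 0ℤ
    cancel = ℤ-Solver.solve-∀
    rest = kernel (λ i j → a * A (suc i) (punchIn p j) - A zero (punchIn p j) * A (suc i) p) r<f
    κ = proj₁ rest
    j₀ = proj₁ (proj₁ (proj₂ rest))
    κ≢0 = proj₂ (proj₁ (proj₂ rest))
    vanishes = proj₂ (proj₂ rest)
    t = sum (λ j → κ j * A zero (punchIn p j))
    κ′≢0 : insertAt (λ j → a * κ j) p (- t) (punchIn p j₀) ≢ 0ℤ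
    κ′≢0 eq with i*j≡0⇒i≡0∨j≡0 a (trans (sym (insertAt-punchIn (λ j → a * κ j) p (- t) j₀)) eq)
    ... | inj₁ a≡0 = a≢0 a≡0
    ... | inj₂ κ≡0 = κ≢0 κ≡0
    expand : ∀ (B : Fin (suc f) → ℤ) → sum (λ j → insertAt (λ j → a * κ j) p (- t) j * B j)
      ≡ - t * B p + a * sum (λ j → κ j * B (punchIn p j))
    expand B = trans (sum-insertAt (λ j → a * κ j) p (- t) B)
      (cong (λ z → - t * B p + z) (trans (sum-cong-≗ (λ j → *-assoc a (κ j) (B (punchIn p j))))
        (sym (*-distribˡ-sum a (λ j → κ j * B (punchIn p j))))))
    eliminated : ∀ i → sum (λ j → κ j * (a * A (suc i) (punchIn p j) - A zero (punchIn p j) * A (suc i) p))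
      ≡ - t * A (suc i) p + a * sum (λ j → κ j * A (suc i) (punchIn p j))
    eliminated i = trans
      (sum-cong-≗ (λ j → regroup (κ j) a (A (suc i) (punchIn p j)) (A zero (punchIn p j)) (A (suc i) p)))
      (trans (sum-linear (- A (suc i) p) a (λ j → κ j * A zero (punchIn p j)) (λ j → κ j * A (suc i) (punchIn p j)))
        (cong (_+ a * sum (λ j → κ j * A (suc i) (punchIn p j))) (swap- (A (suc i) p) t)))
      where
      regroup : ∀ k a x y z → k * (a * x - y * z) ≡ - z * (k * y) + a * (k * x)
      regroup = ℤ-Solver.solve-∀
      swap- : ∀ x y → - x * y ≡ - y * x
      swap- = ℤ-Solver.solve-∀

  -- How far a weight `m` in [0, q] can move before it meets the end that the sign of `κ` points to.
  slack : ℤ → ℤ → ℤ → ℤ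
  slack q m (+ _)    = q - m
  slack q m -[1+ _ ] = m

  *-nonneg : ∀ {i j} → 0ℤ ≤ i → 0ℤ ≤ j → 0ℤ ≤ i * j
  *-nonneg {+ a} {+ b} _ _ = subst (0ℤ ≤_) (pos-* a b) (+≤+ ℕ.z≤n)

  slack-nonneg : ∀ {q m} κ → 0ℤ ≤ m → m ≤ q → 0ℤ ≤ slack q m κ
  slack-nonneg (+ _)    0≤m m≤q = i≤j⇒0≤j-i m≤q
  slack-nonneg -[1+ _ ] 0≤m m≤q = 0≤m

  -- The time after which a weight m moving with velocity κ leaves [0, q]; junk at κ = 0.
  exitTime : ℤ → ℤ → ℤ → ℚᵘ
  exitTime q m κ = mkℚᵘ (slack q m κ) (ℕ.pred ∣ κ ∣)

  -- Comparison of unnormalised rationals is cross multiplication by definition. The cases are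
  -- needed because the denominator, one more than `pred ∣ κ ∣`, reduces only for a visibly nonzero
  -- `κ`.
  exitTime-≤ : ∀ {q m m′} κ κ′ → κ ≢ 0ℤ → κ′ ≢ 0ℤ →
    exitTime q m κ ≤ᵘ exitTime q m′ κ′ →
    slack q m κ * + ∣ κ′ ∣ ≤ slack q m′ κ′ * + ∣ κ ∣
  exitTime-≤ +0       _        κ≢0 _    _ = contradiction refl κ≢0
  exitTime-≤ _        +0       _   κ′≢0 _ = contradiction refl κ′≢0
  exitTime-≤ +[1+ _ ] +[1+ _ ] _   _    t≤t′ = drop-≤ᵘ t≤t′
  exitTime-≤ +[1+ _ ] -[1+ _ ] _   _    t≤t′ = drop-≤ᵘ t≤t′
  exitTime-≤ -[1+ _ ] +[1+ _ ] _   _    t≤t′ = drop-≤ᵘ t≤t′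
  exitTime-≤ -[1+ _ ] -[1+ _ ] _   _    t≤t′ = drop-≤ᵘ t≤t′

  -- At time p / c the numerator `m` has become m + (p / c) κ; multiplying by `c` clears the
  -- fraction and turns the upper end `q` into `c * q`. A weight with `κ` = 0 stays put, so `fits`
  -- is asked of moving weights only.
  moved-in-range : ∀ {c p m q} κ → 0ℤ ≤ c → 0ℤ ≤ p → 0ℤ ≤ m → m ≤ q →
    (κ ≢ 0ℤ → p * + ∣ κ ∣ ≤ slack q m κ * c) →
    0ℤ ≤ c * m + p * κ × c * m + p * κ ≤ c * q
  moved-in-range {c} {p} {m} {q} (+ k) 0≤c 0≤p 0≤m m≤q fits =
    +-mono-≤ (*-nonneg 0≤c 0≤m) (*-nonneg 0≤p (+≤+ ℕ.z≤n)) ,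
    subst₂ _≤_ (+-comm (p * + k) (c * m)) (regroup q m c) (+-monoˡ-≤ (c * m) (fits′ k fits))
    where
    regroup : ∀ q m c → (q - m) * c + c * m ≡ c * q
    regroup = ℤ-Solver.solve-∀
    fits′ : ∀ k → (+ k ≢ 0ℤ → p * + k ≤ (q - m) * c) → p * + k ≤ (q - m) * c
    fits′ zero    _ = subst (_≤ (q - m) * c) (sym (*-zeroʳ p)) (*-nonneg (i≤j⇒0≤j-i m≤q) 0≤c)
    fits′ (suc k) fits = fits λ ()
  moved-in-range {c} {p} {m} {q} -[1+ k ] 0≤c 0≤p 0≤m m≤q fits =
    subst (0ℤ ≤_) (regroup m c p +[1+ k ]) (i≤j⇒0≤j-i (fits λ ())) ,
    subst (c * m + p * -[1+ k ] ≤_) (+-identityʳ (c * q))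
      (+-mono-≤ (*-monoˡ-≤-nonNeg c ⦃ nonNegative 0≤c ⦄ m≤q)
        (subst (_≤ 0ℤ) (neg-distribʳ-* p +[1+ k ]) (neg-mono-≤ (*-nonneg {p} {+[1+ k ]} 0≤p (+≤+ ℕ.z≤n)))))
    where
    regroup : ∀ m c p k → m * c - p * k ≡ c * m + p * - k
    regroup = ℤ-Solver.solve-∀

  -- Time stops at the first exit: no weight has left its interval by then, and the first to exit
  -- sits at 0 or at the upper end, by the sign of its velocity.
  move-to-boundary : ∀ {f} (m κ : Fin f → ℤ) q → (∀ j → 0ℤ ≤ m j) → (∀ j → m j ≤ q) →
    ∃[ j ] κ j ≢ 0ℤ →
    ∃[ c ] ∃[ p ] 0ℤ < c × (∀ j → 0ℤ ≤ c * m j + p * κ j × c * m j + p * κ j ≤ c * q) ×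
    ∃[ i ] (c * m i + p * κ i ≡ 0ℤ ⊎ c * m i + p * κ i ≡ c * q)
  move-to-boundary {f} m κ q 0≤m m≤q (j₀ , κj₀≢0) =
    c , p , 0<c (κ i) κi≢0 ,
    (λ j → moved-in-range (κ j) (<⇒≤ (0<c (κ i) κi≢0)) (slack-nonneg (κ i) (0≤m i) (m≤q i)) (0≤m j) (m≤q j)
      (λ κj≢0 → exitTime-≤ (κ i) (κ j) κi≢0 κj≢0 (All.lookup first (∈-filter⁺ moving? (∈-allFin j) κj≢0)))) ,
    i , tight (κ i)
    where
    moving? = λ j → ¬? (κ j ≟ 0ℤ)
    movers = filter moving? (allFin f)
    time = λ j → exitTime q (m j) (κ j)
    -- `j₀` is the fallback of `argmin`; it moves too, so the minimiser has nonzero velocity. With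
    -- `c` and `p` below, p / c is its exit time.
    i = argmin time j₀ movers
    κi≢0 : κ i ≢ 0ℤ
    κi≢0 = argmin-all time κj₀≢0 (all-filter moving? (allFin f))
    first = f[argmin]≤f[xs] {f = time} j₀ movers
    c = + ∣ κ i ∣
    p = slack q (m i) (κ i)
    0<c : ∀ k → k ≢ 0ℤ → 0ℤ < + ∣ k ∣
    0<c +0       k≢0 = contradiction refl k≢0
    0<c +[1+ _ ] _   = +<+ (ℕ.s≤s ℕ.z≤n)
    0<c -[1+ _ ] _   = +<+ (ℕ.s≤s ℕ.z≤n)
    up : ∀ k m q → k * m + (q - m) * k ≡ k * q
    up = ℤ-Solver.solve-∀
    down : ∀ k m → k * m + m * - k ≡ 0ℤ
    down = ℤ-Solver.solve-∀
    tight : ∀ k → + ∣ k ∣ * m i + slack q (m i) k * k ≡ 0ℤ ⊎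
                  + ∣ k ∣ * m i + slack q (m i) k * k ≡ + ∣ k ∣ * q
    tight (+ k)    = inj₂ (up (+ k) (m i) q)
    tight -[1+ k ] = inj₁ (down +[1+ k ] (m i))

  -- Weights m j / q ∈ [0, 1] of total e on the vectors v j, such that the weighted
  -- sum of the v j together with c₀ (the vectors whose weight is frozen at 1) is 0.
  record Weighting {f d : ℕ} (v : Fin f → Fin d → ℤ) (c₀ : Fin d → ℤ) (e : ℕ) : Set where
    field
      q        : ℤ
      m        : Fin f → ℤ
      0<q      : 0ℤ < q
      0≤m      : ∀ j → 0ℤ ≤ m j
      m≤q      : ∀ j → m j ≤ q
      total    : sum m ≡ + e * q
      balanced : ∀ i → sum (λ j → m j * v j i) + q * c₀ i ≡ 0ℤ

  open Weighting

  *-pos : ∀ {i j} → 0ℤ < i → 0ℤ < j → 0ℤ < i * j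
  *-pos {+[1+ a ]} {+[1+ b ]} _ _ = +<+ (ℕ.s≤s ℕ.z≤n)
  *-pos {+0} (+<+ ())
  *-pos {+[1+ a ]} {+0} _ (+<+ ())

  total-zero : ∀ {f} (m : Fin f → ℤ) → (∀ j → 0ℤ ≤ m j) → sum m ≡ 0ℤ → ∀ j → m j ≡ 0ℤ
  total-zero {suc f} m 0≤m Σ≡0 j = ≤-antisym (begin
    m j                      ≡⟨ +-identityʳ (m j) ⟨
    m j + 0ℤ                 ≤⟨ +-monoʳ-≤ (m j) (subst (_≤ sum (removeAt m j)) (sum-replicate-zero f)
                                  (sum-mono-≤ {u = λ _ → 0ℤ} (λ k → 0≤m (punchIn j k)))) ⟩
    m j + sum (removeAt m j) ≡⟨ sum-remove {i = j} m ⟨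
    sum m                    ≡⟨ Σ≡0 ⟩
    0ℤ                       ∎) (0≤m j)
    where open ≤-Reasoning

  -- The two vanishing sums of `κ` preserve the total and the weighted sum. The factor `1ℤ` matches
  -- the row of ones in the matrix given to `kernel`.
  moveAlong : ∀ {f d e} {v : Fin f → Fin d → ℤ} {c₀} (W : Weighting v c₀ e) (κ : Fin f → ℤ) c p →
    sum (λ j → κ j * 1ℤ) ≡ 0ℤ → (∀ i → sum (λ j → κ j * v j i) ≡ 0ℤ) → 0ℤ < c →
    (∀ j → 0ℤ ≤ c * m W j + p * κ j × c * m W j + p * κ j ≤ c * q W) → Weighting v c₀ e
  moveAlong {f} {e = e} {v} {c₀} W κ c p Σκ≡0 Σκv≡0 0<c inRange = record
    { q = c * q W ; m = λ j → c * m W j + p * κ j ; 0<q = *-pos 0<c (0<q W)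
    ; 0≤m = λ j → proj₁ (inRange j) ; m≤q = λ j → proj₂ (inRange j)
    ; total = begin
        sum (λ j → c * m W j + p * κ j)  ≡⟨ sum-linear c p (m W) κ ⟩
        c * sum (m W) + p * sum κ        ≡⟨ cong₂ (λ x y → c * x + p * y) (total W) Σκ ⟩
        c * (+ e * q W) + p * 0ℤ         ≡⟨ scale c (+ e) (q W) p ⟩
        + e * (c * q W)                  ∎
    ; balanced = λ i → begin
        sum (λ j → (c * m W j + p * κ j) * v j i) + c * q W * c₀ i
          ≡⟨ cong (_+ c * q W * c₀ i) (trans (sum-cong-≗ (λ j → distrib c (m W j) p (κ j) (v j i)))
               (sum-linear c p (λ j → m W j * v j i) (λ j → κ j * v j i))) ⟩
        c * sum (λ j → m W j * v j i) + p * sum (λ j → κ j * v j i) + c * q W * c₀ i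
          ≡⟨ cong (λ y → c * sum (λ j → m W j * v j i) + p * y + c * q W * c₀ i) (Σκv≡0 i) ⟩
        c * sum (λ j → m W j * v j i) + p * 0ℤ + c * q W * c₀ i
          ≡⟨ factor c (sum (λ j → m W j * v j i)) p (q W) (c₀ i) ⟩
        c * (sum (λ j → m W j * v j i) + q W * c₀ i)
          ≡⟨ cong (c *_) (balanced W i) ⟩
        c * 0ℤ ≡⟨ *-zeroʳ c ⟩
        0ℤ ∎ }
    where
    open ≡-Reasoning
    Σκ : sum κ ≡ 0ℤ
    Σκ = trans (sum-cong-≗ (λ j → sym (*-identityʳ (κ j)))) Σκ≡0
    scale : ∀ c e q p → c * (e * q) + p * 0ℤ ≡ e * (c * q)
    scale = ℤ-Solver.solve-∀
    distrib : ∀ c m p k v → (c * m + p * k) * v ≡ c * (m * v) + p * (k * v)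
    distrib = ℤ-Solver.solve-∀
    factor : ∀ c s p q x → c * s + p * 0ℤ + c * q * x ≡ c * (s + q * x)
    factor = ℤ-Solver.solve-∀

  -- A vector of weight 1 contributes `q * v i`, which the constant term absorbs while the total
  -- drops by one; this drives the recursion on the total in `some-weight-vanishes`.
  freeze : ∀ {f d e} {v : Fin (suc f) → Fin d → ℤ} {c₀} (W : Weighting v c₀ (suc e)) i →
    m W i ≡ q W → Weighting (v ∘ punchIn i) (λ r → c₀ r + v i r) e
  freeze {e = e} {v} {c₀} W i full = record
    { q = q W ; m = m W ∘ punchIn i ; 0<q = 0<q W
    ; 0≤m = 0≤m W ∘ punchIn i ; m≤q = m≤q W ∘ punchIn i
    ; total = ∙-cancelˡ (q W) _ _ (begin
        q W + sum (m W ∘ punchIn i)    ≡⟨ cong (_+ sum (m W ∘ punchIn i)) full ⟨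
        m W i + sum (m W ∘ punchIn i)  ≡⟨ sum-remove {i = i} (m W) ⟨
        sum (m W)                      ≡⟨ total W ⟩
        + suc e * q W                  ≡⟨ suc-* (+ e) (q W) ⟩
        q W + + e * q W                ∎)
    ; balanced = λ r → begin
        sum (λ j → m W (punchIn i j) * v (punchIn i j) r) + q W * (c₀ r + v i r)
          ≡⟨ regroup (sum (λ j → m W (punchIn i j) * v (punchIn i j) r)) (q W) (c₀ r) (v i r) ⟩
        q W * v i r + sum (λ j → m W (punchIn i j) * v (punchIn i j) r) + q W * c₀ r
          ≡⟨ cong (λ x → x * v i r + sum (λ j → m W (punchIn i j) * v (punchIn i j) r) + q W * c₀ r) full ⟨
        m W i * v i r + sum (λ j → m W (punchIn i j) * v (punchIn i j) r) + q W * c₀ r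
          ≡⟨ cong (_+ q W * c₀ r) (sum-remove {i = i} (λ j → m W j * v j r)) ⟨
        sum (λ j → m W j * v j r) + q W * c₀ r
          ≡⟨ balanced W r ⟩
        0ℤ ∎ }
    where
    open ≡-Reasoning
    regroup : ∀ s q c v → s + q * (c + v) ≡ q * v + s + q * c
    regroup = ℤ-Solver.solve-∀

  unfreeze : ∀ {f d e} {v : Fin (suc f) → Fin d → ℤ} {c₀} i →
    Weighting (v ∘ punchIn i) (λ r → c₀ r + v i r) e → Weighting v c₀ (suc e)
  unfreeze {e = e} {v} {c₀} i W = record
    { q = q W ; m = insertAt (m W) i (q W) ; 0<q = 0<q W
    ; 0≤m = insertAt-all (0ℤ ≤_) (m W) i (q W) (<⇒≤ (0<q W)) (0≤m W)
    ; m≤q = insertAt-all (_≤ q W) (m W) i (q W) ≤-refl (m≤q W)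
    ; total = begin
        sum (insertAt (m W) i (q W))
          ≡⟨ sum-cong-≗ (λ j → sym (*-identityʳ (insertAt (m W) i (q W) j))) ⟩
        sum (λ j → insertAt (m W) i (q W) j * 1ℤ)
          ≡⟨ sum-insertAt (m W) i (q W) (λ _ → 1ℤ) ⟩
        q W * 1ℤ + sum (λ j → m W j * 1ℤ)
          ≡⟨ cong₂ _+_ (*-identityʳ (q W)) (trans (sum-cong-≗ (λ j → *-identityʳ (m W j))) (total W)) ⟩
        q W + + e * q W
          ≡⟨ suc-* (+ e) (q W) ⟨
        + suc e * q W ∎
    ; balanced = λ r → begin
        sum (λ j → insertAt (m W) i (q W) j * v j r) + q W * c₀ r
          ≡⟨ cong (_+ q W * c₀ r) (sum-insertAt (m W) i (q W) (λ j → v j r)) ⟩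
        q W * v i r + sum (λ j → m W j * v (punchIn i j) r) + q W * c₀ r
          ≡⟨ regroup (sum (λ j → m W j * v (punchIn i j) r)) (q W) (c₀ r) (v i r) ⟨
        sum (λ j → m W j * v (punchIn i j) r) + q W * (c₀ r + v i r)
          ≡⟨ balanced W r ⟩
        0ℤ ∎ }
    where
    open ≡-Reasoning
    regroup : ∀ s q c v → s + q * (c + v) ≡ q * v + s + q * c
    regroup = ℤ-Solver.solve-∀

  -- With more than d + 1 vectors of weight still free, moving along a linear
  -- dependency makes another weight 0 or 1; the total rules out that all become 1.
  some-weight-vanishes : ∀ {d} e {v : Fin (suc (e ℕ.+ d)) → Fin d → ℤ} {c₀} →
    Weighting v c₀ e → Σ[ W ∈ Weighting v c₀ e ] ∃[ j ] m W j ≡ 0ℤ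
  some-weight-vanishes zero W = W , zero , total-zero (m W) (0≤m W) (trans (total W) (*-zeroˡ (q W))) zero
  some-weight-vanishes {d} (suc e) {v} W
    -- There are d + 1 equations: the row of ones preserves the total, the others the weighted sum.
    with κ , κ≢0 , vanishes ← kernel {suc d} (λ { zero _ → 1ℤ ; (suc i) j → v j i })
           (ℕ.s≤s (ℕ.s≤s (ℕ.m≤n+m d e)))
    with c , p , 0<c , inRange , i , tight ← move-to-boundary (m W) κ (q W) (0≤m W) (m≤q W) κ≢0
    with tight
  ... | inj₁ zero-i = moveAlong W κ c p (vanishes zero) (vanishes ∘ suc) 0<c inRange , i , zero-i
  ... | inj₂ full-i
    with W″ , j , zero-j ← some-weight-vanishes e
           (freeze (moveAlong W κ c p (vanishes zero) (vanishes ∘ suc) 0<c inRange) i full-i)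
    = unfreeze i W″ , punchIn i j , trans (insertAt-punchIn (m W″) i (q W″) j) zero-j

  discard : ∀ {f d e} {v : Fin (suc f) → Fin d → ℤ} {c₀} (W : Weighting v c₀ e) i →
    m W i ≡ 0ℤ → Weighting (v ∘ punchIn i) c₀ e
  discard {e = e} {v} {c₀} W i zero-i = record
    { q = q W ; m = m W ∘ punchIn i ; 0<q = 0<q W
    ; 0≤m = 0≤m W ∘ punchIn i ; m≤q = m≤q W ∘ punchIn i
    ; total = begin
        sum (m W ∘ punchIn i)          ≡⟨ +-identityˡ _ ⟨
        0ℤ + sum (m W ∘ punchIn i)     ≡⟨ cong (_+ sum (m W ∘ punchIn i)) zero-i ⟨
        m W i + sum (m W ∘ punchIn i)  ≡⟨ sum-remove {i = i} (m W) ⟨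
        sum (m W)                      ≡⟨ total W ⟩
        + e * q W                      ∎
    ; balanced = λ r → begin
        sum (λ j → m W (punchIn i j) * v (punchIn i j) r) + q W * c₀ r
          ≡⟨ cong (_+ q W * c₀ r) (+-identityˡ (sum (λ j → m W (punchIn i j) * v (punchIn i j) r))) ⟨
        0ℤ * v i r + sum (λ j → m W (punchIn i j) * v (punchIn i j) r) + q W * c₀ r
          ≡⟨ cong (λ x → x * v i r + sum (λ j → m W (punchIn i j) * v (punchIn i j) r) + q W * c₀ r) zero-i ⟨
        m W i * v i r + sum (λ j → m W (punchIn i j) * v (punchIn i j) r) + q W * c₀ r
          ≡⟨ cong (_+ q W * c₀ r) (sum-remove {i = i} (λ j → m W j * v j r)) ⟨
        sum (λ j → m W j * v j r) + q W * c₀ r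
          ≡⟨ balanced W r ⟩
        0ℤ ∎ }
    where open ≡-Reasoning

  -- All weights are multiplied by e / (e + 1). Scaling respects the balance because nothing is
  -- frozen: the constant term is 0.
  shrink : ∀ {f d e} {v : Fin f → Fin d → ℤ} → Weighting v (λ _ → 0ℤ) (suc e) → Weighting v (λ _ → 0ℤ) e
  shrink {e = e} {v} W = record
    { q = + suc e * q W ; m = λ j → + e * m W j ; 0<q = *-pos {+ suc e} {q W} (+<+ (ℕ.s≤s ℕ.z≤n)) (0<q W)
    ; 0≤m = λ j → *-nonneg {+ e} (+≤+ ℕ.z≤n) (0≤m W j)
    ; m≤q = λ j → ≤-trans (*-monoˡ-≤-nonNeg (+ e) (m≤q W j))
        (*-monoʳ-≤-nonNeg (q W) ⦃ nonNegative (<⇒≤ (0<q W)) ⦄ (i≤suc[i] (+ e)))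
    ; total = trans (sym (*-distribˡ-sum (+ e) (m W))) (cong (+ e *_) (total W))
    ; balanced = λ r → begin
        sum (λ j → + e * m W j * v j r) + + suc e * q W * 0ℤ
          ≡⟨ cong₂ _+_ (trans (sum-cong-≗ (λ j → *-assoc (+ e) (m W j) (v j r)))
               (sym (*-distribˡ-sum (+ e) (λ j → m W j * v j r)))) (*-zeroʳ (+ suc e * q W)) ⟩
        + e * sum (λ j → m W j * v j r) + 0ℤ
          ≡⟨ regroup (+ e) (sum (λ j → m W j * v j r)) (q W) ⟩
        + e * (sum (λ j → m W j * v j r) + q W * 0ℤ)
          ≡⟨ trans (cong (+ e *_) (balanced W r)) (*-zeroʳ (+ e)) ⟩
        0ℤ ∎ }
    where
    open ≡-Reasoning
    regroup : ∀ e s q → e * s + 0ℤ ≡ e * (s + q * 0ℤ)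
    regroup = ℤ-Solver.solve-∀

  -- The start of the process: equal weights (e + 1) / (e + 1 + d) turn a vanishing plain sum into a
  -- vanishing weighted sum.
  uniform : ∀ {d} e {v : Fin (suc e ℕ.+ d) → Fin d → ℤ} → (∀ i → sum (λ j → v j i) ≡ 0ℤ) →
    Weighting v (λ _ → 0ℤ) (suc e)
  uniform {d} e {v} Σv≡0 = record
    { q = + (suc e ℕ.+ d) ; m = λ _ → + suc e ; 0<q = +<+ (ℕ.s≤s ℕ.z≤n)
    ; 0≤m = λ _ → +≤+ ℕ.z≤n ; m≤q = λ _ → +≤+ (ℕ.m≤m+n (suc e) d)
    ; total = trans (sum-const (suc e ℕ.+ d) (+ suc e)) (*-comm (+ (suc e ℕ.+ d)) (+ suc e))
    ; balanced = λ i → trans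
        (cong₂ _+_ (sym (*-distribˡ-sum (+ suc e) (λ j → v j i))) (*-zeroʳ (+ (suc e ℕ.+ d))))
        (trans (+-identityʳ _) (trans (cong (+ suc e *_) (Σv≡0 i)) (*-zeroʳ (+ suc e)))) }

  -- q Σ w = Σ (q - m) w, and the complementary weights have total d.
  sum-≤ : ∀ {d e} {v : Fin (e ℕ.+ d) → Fin d → ℤ} (W : Weighting v (λ _ → 0ℤ) e) →
    ∀ Δ (w : Fin (e ℕ.+ d) → ℤ) → (∀ j → w j ≤ Δ) →
    sum (λ j → m W j * w j) ≡ 0ℤ → sum w ≤ + d * Δ
  sum-≤ {d} {e} W Δ w w≤Δ Σmw≡0 = *-cancelˡ-≤-pos (sum w) (+ d * Δ) (q W) ⦃ positive (0<q W) ⦄ (begin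
    q W * sum w
      ≡⟨ expand (q W) (sum w) ⟩
    q W * sum w + -1ℤ * 0ℤ
      ≡⟨ cong (λ z → q W * sum w + -1ℤ * z) Σmw≡0 ⟨
    q W * sum w + -1ℤ * sum (λ j → m W j * w j)
      ≡⟨ sum-linear (q W) -1ℤ w (λ j → m W j * w j) ⟨
    sum (λ j → q W * w j + -1ℤ * (m W j * w j))
      ≤⟨ sum-mono-≤ (λ j → subst₂ _≤_ (regroup (q W) (m W j) (w j)) (regroup′ (q W) (m W j) Δ)
           (*-monoˡ-≤-nonNeg (q W - m W j) ⦃ nonNegative (i≤j⇒0≤j-i (m≤q W j)) ⦄ (w≤Δ j))) ⟩
    sum (λ j → (q W * Δ) * 1ℤ + - Δ * m W j)
      ≡⟨ sum-linear (q W * Δ) (- Δ) (λ _ → 1ℤ) (m W) ⟩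
    q W * Δ * sum {e ℕ.+ d} (λ _ → 1ℤ) + - Δ * sum (m W)
      ≡⟨ cong₂ (λ x y → q W * Δ * x + - Δ * y)
           (trans (sum-const (e ℕ.+ d) 1ℤ) (trans (*-identityʳ (+ (e ℕ.+ d))) (pos-+ e d))) (total W) ⟩
    q W * Δ * (+ e + + d) + - Δ * (+ e * q W)
      ≡⟨ collect (q W) Δ (+ e) (+ d) ⟩
    q W * (+ d * Δ) ∎)
    where
    open ≤-Reasoning
    expand : ∀ q s → q * s ≡ q * s + -1ℤ * 0ℤ
    expand = ℤ-Solver.solve-∀
    regroup : ∀ q m w → (q - m) * w ≡ q * w + -1ℤ * (m * w)
    regroup = ℤ-Solver.solve-∀
    regroup′ : ∀ q m Δ → (q - m) * Δ ≡ (q * Δ) * 1ℤ + - Δ * m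
    regroup′ = ℤ-Solver.solve-∀
    collect : ∀ q Δ e d → q * Δ * (e + d) + - Δ * (e * q) ≡ q * (d * Δ)
    collect = ℤ-Solver.solve-∀

-- The Steinitz lemma, and the splitting of long zero-sum families.

module Steinitz {a} {X : Set a} {d : ℕ} (v : X → Fin d → ℤ.ℤ) (Δ : ℕ)
  (v≤Δ : ∀ x i → v x i ℤ.≤ ℤ.+ Δ) (-v≤Δ : ∀ x i → ℤ.- v x i ℤ.≤ ℤ.+ Δ) where

  open Weightings
  open import Algebra.Properties.AbelianGroup ℤ.+-0-abelianGroup using (∙-cancelʳ)
  open import Algebra.Properties.Semiring.Sum ℤ.+-*-semiring
  open import Data.Integer.Base hiding (suc)
  open import Data.Integer.Properties
  open import Data.List.Relation.Binary.Permutation.Propositional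
    using (_↭_; ↭-refl; ↭-trans; ↭-prep; ↭-swap)
  import Data.List.Relation.Binary.Permutation.Propositional.Properties as Perm
  open ≡ using (refl; sym; trans)

  vsum : List X → Fin d → ℤ
  vsum []       i = 0ℤ
  vsum (x ∷ xs) i = v x i + vsum xs i

  vsum-++ : ∀ xs ys i → vsum (xs ++ ys) i ≡ vsum xs i + vsum ys i
  vsum-++ []       ys i = sym (+-identityˡ (vsum ys i))
  vsum-++ (x ∷ xs) ys i = trans (cong (λ s → v x i + s) (vsum-++ xs ys i))
    (sym (+-assoc (v x i) (vsum xs i) (vsum ys i)))

  vsum-↭ : ∀ {xs ys} → xs ↭ ys → ∀ i → vsum xs i ≡ vsum ys i
  vsum-↭ _↭_.refl i = refl
  vsum-↭ (_↭_.prep x p) i = cong (λ s → v x i + s) (vsum-↭ p i)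
  vsum-↭ (_↭_.swap {ys = ys} x y p) i = trans
    (cong (λ s → v x i + (v y i + s)) (vsum-↭ p i)) (exchange (v x i) (v y i) (vsum ys i))
    where
    exchange : ∀ a b s → a + (b + s) ≡ b + (a + s)
    exchange = ℤ-Solver.solve-∀
  vsum-↭ (_↭_.trans p q) i = trans (vsum-↭ p i) (vsum-↭ q i)

  vsum-tabulate : ∀ {t} (x : Fin t → X) i → vsum (tabulate x) i ≡ sum (λ j → v (x j) i)
  vsum-tabulate {zero}  x i = refl
  vsum-tabulate {suc t} x i = cong (λ s → v (x zero) i + s) (vsum-tabulate (x ∘ suc) i)

  tabulate-↭-punchIn : ∀ {t} (x : Fin (suc t) → X) j → tabulate x ↭ x j ∷ tabulate (x ∘ punchIn j)
  tabulate-↭-punchIn         x zero    = ↭-refl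
  tabulate-↭-punchIn {suc t} x (suc j) =
    ↭-trans (↭-prep (x zero) (tabulate-↭-punchIn (x ∘ suc) j)) (↭-swap (x zero) (x (suc j)) ↭-refl)

  radius : ℕ
  radius = d ℕ.* Δ

  InBox : (Fin d → ℤ) → Set
  InBox s = ∀ i → s i ≤ + radius × - s i ≤ + radius

  short-inBox : ∀ xs → length xs ℕ.≤ d → InBox (vsum xs)
  short-inBox xs len≤d i = ≤-trans (proj₁ (go xs)) len*Δ≤ , ≤-trans (proj₂ (go xs)) len*Δ≤
    where
    len*Δ≤ : + (length xs ℕ.* Δ) ≤ + radius
    len*Δ≤ = +≤+ (ℕ.*-monoˡ-≤ Δ len≤d)
    go : ∀ xs → vsum xs i ≤ + (length xs ℕ.* Δ) × - vsum xs i ≤ + (length xs ℕ.* Δ)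
    go []       = ≤-refl , ≤-refl
    go (x ∷ xs) = +-mono-≤ (v≤Δ x i) (proj₁ (go xs)) ,
      subst (_≤ + (Δ ℕ.+ length xs ℕ.* Δ)) (sym (neg-distrib-+ (v x i) (vsum xs i)))
        (+-mono-≤ (-v≤Δ x i) (proj₂ (go xs)))

  weighted-inBox : ∀ e (x : Fin (e ℕ.+ d) → X) → Weighting (v ∘ x) (λ _ → 0ℤ) e →
    InBox (vsum (tabulate x))
  weighted-inBox e x W i =
    subst₂ _≤_ (sym (vsum-tabulate x i)) (sym (pos-* d Δ))
      (sum-≤ {e = e} W (+ Δ) (λ j → v (x j) i) (λ j → v≤Δ (x j) i) balanced₀) ,
    subst₂ _≤_ (trans Σ- (cong -_ (sym (vsum-tabulate x i)))) (sym (pos-* d Δ))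
      (sum-≤ {e = e} W (+ Δ) (λ j → - v (x j) i) (λ j → -v≤Δ (x j) i) balanced₁)
    where
    open Weighting W
    open ≡-Reasoning
    balanced₀ : sum (λ j → m j * v (x j) i) ≡ 0ℤ
    balanced₀ = begin
      sum (λ j → m j * v (x j) i)           ≡⟨ +-identityʳ _ ⟨
      sum (λ j → m j * v (x j) i) + 0ℤ      ≡⟨ cong (λ s → sum (λ j → m j * v (x j) i) + s) (*-zeroʳ q) ⟨
      sum (λ j → m j * v (x j) i) + q * 0ℤ  ≡⟨ balanced i ⟩
      0ℤ ∎
    sum-neg : ∀ {t} (w : Fin t → ℤ) → sum (λ j → - w j) ≡ - sum w
    sum-neg w = begin
      sum (λ j → - w j)     ≡⟨ sum-cong-≗ (λ j → sym (-1*i≡-i (w j))) ⟩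
      sum (λ j → -1ℤ * w j) ≡⟨ *-distribˡ-sum -1ℤ w ⟨
      -1ℤ * sum w           ≡⟨ -1*i≡-i (sum w) ⟩
      - sum w ∎
    Σ- = sum-neg (λ j → v (x j) i)
    balanced₁ : sum (λ j → m j * - v (x j) i) ≡ 0ℤ
    balanced₁ = begin
      sum (λ j → m j * - v (x j) i)    ≡⟨ sum-cong-≗ (λ j → sym (neg-distribʳ-* (m j) (v (x j) i))) ⟩
      sum (λ j → - (m j * v (x j) i))  ≡⟨ sum-neg (λ j → m j * v (x j) i) ⟩
      - sum (λ j → m j * v (x j) i)    ≡⟨ cong -_ balanced₀ ⟩
      0ℤ ∎

  -- The vector whose weight vanishes goes to the front, so the suffixes are the families that
  -- remain, each with a weighting that bounds its sum; suffixes of at most d vectors are bounded by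
  -- their number alone.
  order-weighted : ∀ e (x : Fin (e ℕ.+ d) → X) → Weighting (v ∘ x) (λ _ → 0ℤ) e →
    ∃[ ys ] tabulate x ↭ ys × (∀ k → InBox (vsum (drop k ys)))
  order-weighted zero x _ = tabulate x , ↭-refl , λ k → short-inBox (drop k (tabulate x))
    (ℕ.≤-trans (ℕ.≤-reflexive (length-drop k (tabulate x)))
      (ℕ.≤-trans (ℕ.m∸n≤m (length (tabulate x)) k) (ℕ.≤-reflexive (length-tabulate x))))
  order-weighted (suc e) x W
    -- Shrinking leaves `suc e ℕ.+ d` vectors for the total `e`, one more than total plus d: the
    -- surplus that forces a weight to 0.
    with W′ , j , mj≡0 ← some-weight-vanishes e (shrink W)
    with ys , p , inBox ← order-weighted e (x ∘ punchIn j) (discard W′ j mj≡0)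
    = x j ∷ ys , p′ , λ where
        zero    i → subst (λ s → s ≤ + radius × - s ≤ + radius) (vsum-↭ p′ i) (weighted-inBox (suc e) x W i)
        (suc k)   → inBox k
    where
    p′ : tabulate x ↭ x j ∷ ys
    p′ = ↭-trans (tabulate-↭-punchIn x j) (↭-prep (x j) p)

  steinitz : ∀ xs → (∀ i → vsum xs i ≡ 0ℤ) → ∃[ ys ] xs ↭ ys × (∀ k → InBox (vsum (drop k ys)))
  steinitz xs Σ≡0 with length xs ℕ.≤? d
  ... | yes len≤d = xs , ↭-refl , λ k → short-inBox (drop k xs)
    (ℕ.≤-trans (ℕ.≤-reflexive (length-drop k xs)) (ℕ.≤-trans (ℕ.m∸n≤m (length xs) k) len≤d))
  ... | no len≰d = subst (λ zs → ∃[ ys ] zs ↭ ys × (∀ k → InBox (vsum (drop k ys)))) (tabulate-lookup xs)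
      (go (length xs) (length xs ℕ.∸ suc d) (lookup xs)
        (sym (trans (sym (ℕ.+-suc _ d)) (ℕ.m∸n+n≡m (ℕ.≰⇒> len≰d))))
        (λ i → trans (cong (λ zs → vsum zs i) (tabulate-lookup xs)) (Σ≡0 i)))
    where
    -- A variable `t` in place of `length xs` allows the length equation to be matched with `refl`.
    go : ∀ t e (x : Fin t → X) → t ≡ suc e ℕ.+ d → (∀ i → vsum (tabulate x) i ≡ 0ℤ) →
      ∃[ ys ] tabulate x ↭ ys × (∀ k → InBox (vsum (drop k ys)))
    go _ e x refl Σ≡0 = order-weighted (suc e) x
      (uniform e (λ i → trans (sym (vsum-tabulate x i)) (Σ≡0 i)))

  -- The number of integer points in [-radius, radius]^d.
  boxSize : ℕ
  boxSize = suc (2 ℕ.* radius) ℕ.^ d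

  0≤shifted : ∀ {s} → - s ≤ + radius → 0ℤ ≤ s + + radius
  0≤shifted {s} -s≤R = subst (0ℤ ≤_) (flip (+ radius) s) (i≤j⇒0≤j-i -s≤R)
    where
    flip : ∀ r s → r - - s ≡ s + r
    flip = ℤ-Solver.solve-∀

  shifted< : ∀ s → s ≤ + radius × - s ≤ + radius → ∣ s + + radius ∣ ℕ.< suc (2 ℕ.* radius)
  shifted< s (s≤R , -s≤R) = ℕ.s≤s (drop‿+≤+ (begin
    + ∣ s + + radius ∣      ≡⟨ 0≤i⇒+∣i∣≡i (0≤shifted -s≤R) ⟩
    s + + radius            ≤⟨ +-monoˡ-≤ (+ radius) s≤R ⟩
    + radius + + radius     ≡⟨ cong (λ r → + (radius ℕ.+ r)) (ℕ.+-identityʳ radius) ⟨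
    + (2 ℕ.* radius)        ∎))
    where open ≤-Reasoning

  shift-injective : ∀ {s t} → s ≤ + radius × - s ≤ + radius → t ≤ + radius × - t ≤ + radius →
    ∣ s + + radius ∣ ≡ ∣ t + + radius ∣ → s ≡ t
  shift-injective {s} {t} (_ , -s≤R) (_ , -t≤R) eq = ∙-cancelʳ (+ radius) s t
    (trans (sym (0≤i⇒+∣i∣≡i (0≤shifted -s≤R))) (trans (cong +_ eq) (0≤i⇒+∣i∣≡i (0≤shifted -t≤R))))

  encode : ∀ s → InBox s → Fin boxSize
  encode s inBox = funToFin (λ i → fromℕ< (shifted< (s i) (inBox i)))

  encode-injective : ∀ {s t} (p : InBox s) (q : InBox t) → encode s p ≡ encode t q → ∀ i → s i ≡ t i
  encode-injective {s} {t} p q same i = shift-injective (p i) (q i)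
    (Fin.fromℕ<-injective _ _ (shifted< (s i) (p i)) (shifted< (t i) (q i))
      (trans (sym (Fin.finToFun-funToFin (λ i → fromℕ< (shifted< (s i) (p i))) i))
        (trans (cong (λ c → finToFun c i) same)
          (Fin.finToFun-funToFin (λ i → fromℕ< (shifted< (t i) (q i))) i))))

  SplitsIntoZeroSums : List X → Set a
  SplitsIntoZeroSums xs = ∃[ ys ] ∃[ zs ] xs ↭ ys ++ zs × ys ≢ [] × zs ≢ [] ×
    (∀ i → vsum ys i ≡ 0ℤ) × (∀ i → vsum zs i ≡ 0ℤ)

  -- The block between the two positions carries the difference of the suffix sums, hence sum 0, and
  -- so does the rest, as the whole does. Since `l` is below the length, `cs` is non-empty and the
  -- rest with it.
  repeated-sum-splits : ∀ xs k l → k ℕ.< l → l ℕ.< length xs →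
    (∀ i → vsum (drop k xs) i ≡ vsum (drop l xs) i) → (∀ i → vsum xs i ≡ 0ℤ) → SplitsIntoZeroSums xs
  repeated-sum-splits xs k l k<l l<n same Σ≡0
    with as , bs , cs , refl , bs≢[] , cs≢[] , at-k , at-l ← split-at-drops k l xs k<l l<n
    = bs , as ++ cs , p , bs≢[] , (λ eq → cs≢[] (++-conicalʳ as cs eq)) , Σbs≡0 , λ i → begin
        vsum (as ++ cs) i              ≡⟨ +-identityˡ _ ⟨
        0ℤ + vsum (as ++ cs) i         ≡⟨ cong (_+ vsum (as ++ cs) i) (Σbs≡0 i) ⟨
        vsum bs i + vsum (as ++ cs) i  ≡⟨ vsum-++ bs (as ++ cs) i ⟨
        vsum (bs ++ as ++ cs) i        ≡⟨ vsum-↭ p i ⟨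
        vsum (as ++ bs ++ cs) i        ≡⟨ Σ≡0 i ⟩
        0ℤ                             ∎
    where
    open ≡-Reasoning
    p : as ++ bs ++ cs ↭ bs ++ as ++ cs
    p = Perm.shifts as bs
    Σbs≡0 : ∀ i → vsum bs i ≡ 0ℤ
    Σbs≡0 i = ∙-cancelʳ (vsum cs i) (vsum bs i) 0ℤ
      (trans (sym (vsum-++ bs cs i)) (trans (subst₂ (λ ys zs → vsum ys i ≡ vsum zs i) at-k at-l (same i))
        (sym (+-identityˡ (vsum cs i)))))

  zero-sum-splits : ∀ xs → (∀ i → vsum xs i ≡ 0ℤ) → boxSize ℕ.< length xs → SplitsIntoZeroSums xs
  zero-sum-splits xs Σ≡0 size<len =
    let ws , p , inBox = steinitz xs Σ≡0
        k , l , k<l , same = Fin.pigeonhole (subst (boxSize ℕ.<_) (Perm.↭-length p) size<len)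
          (λ k → encode (vsum (drop (toℕ k) ws)) (inBox (toℕ k)))
        ys , zs , q , rest = repeated-sum-splits ws (toℕ k) (toℕ l) k<l (Fin.toℕ<n l)
          (encode-injective (inBox (toℕ k)) (inBox (toℕ l)) same)
          (λ i → trans (sym (vsum-↭ p i)) (Σ≡0 i))
    in ys , zs , ↭-trans p q , rest

-- Free abelian monoids: search among divisors, gcd and distance.

module Divisibility {a ℓ} (S : Setoid a ℓ) where

  open Setoid S using (_≈_) renaming (Carrier to A; refl to ≈-refl; sym to ≈-sym)
  open FreeAbelianMonoid S
  open ≡ using (refl; sym; trans)
  open import Data.List.Relation.Binary.Permutation.Setoid S using (↭-refl; ↭-sym; ↭-trans; ↭-prep; ↭-swap; prep)
  open import Data.List.Relation.Binary.Permutation.Setoid.Properties S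
    using ( ¬x∷xs↭[]; ++⁺ˡ; ++⁺ʳ; ++-commutativeMonoid; drop-∷; xs↭ys⇒|xs|≡|ys|; ↭-shift; ∈-resp-↭ )
    renaming (++-assoc to ↭-assoc; ++-identityʳ to ↭-identityʳ)
  open import Data.List.Membership.Setoid S using (_∈_)
  open import Data.List.Membership.Setoid.Properties using (∈-++⁻; ∈-++⁺ˡ)
  open RawMagmaDefs (CommutativeMonoid.rawMagma ++-commutativeMonoid) public using () renaming (_,_ to _by_)

  ∈⇒↭ : ∀ {x ys} → x ∈ ys → ∃[ zs ] ys ↭ x ∷ zs
  ∈⇒↭ {ys = y ∷ ys} (here x≈y)  = ys , prep (≈-sym x≈y) ↭-refl
  ∈⇒↭ {ys = y ∷ ys} (there x∈ys) =
    let zs , p = ∈⇒↭ x∈ys in y ∷ zs , ↭-trans (↭-prep y p) (↭-swap y _ ↭-refl)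

  ↭[]⇒≡[] : ∀ {xs} → xs ↭ [] → xs ≡ []
  ↭[]⇒≡[] {[]}     _ = refl
  ↭[]⇒≡[] {x ∷ xs} p = contradiction p ¬x∷xs↭[]

  ∣-refl : ∀ {x} → x ∣ x
  ∣-refl {x} = [] by ↭-identityʳ x

  ∣-trans : ∀ {x y z} → x ∣ y → y ∣ z → x ∣ z
  ∣-trans {x} (q by xq↭y) (r by yr↭z) =
    (q ++ r) by ↭-trans (↭-sym (↭-assoc x q r)) (↭-trans (++⁺ʳ r xq↭y) yr↭z)

  ↭⇒∣ : ∀ {x y} → x ↭ y → x ∣ y
  ↭⇒∣ {x} x↭y = [] by ↭-trans (↭-identityʳ x) x↭y

  []∣ : ∀ x → [] ∣ x
  []∣ x = x by ↭-refl

  ∷⁺-∣ : ∀ a {x y} → x ∣ y → a ∷ x ∣ a ∷ y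
  ∷⁺-∣ a (q by xq↭y) = q by ↭-prep a xq↭y

  ∣-∷ʳ : ∀ a {x y} → x ∣ y → x ∣ a ∷ y
  ∣-∷ʳ a {x} (q by xq↭y) = (a ∷ q) by ↭-trans (↭-shift x q) (↭-prep a xq↭y)

  -- The head `a` of the product lies in `x` or in the quotient and can be cancelled there. This
  -- makes recursion on the list possible although equality is only up to permutation.
  ∣-∷⁻ : ∀ {a x y} → x ∣ a ∷ y → (∃[ x₁ ] x ↭ a ∷ x₁ × x₁ ∣ y) ⊎ x ∣ y
  ∣-∷⁻ {a} {x} {y} (q by xq↭ay) with ∈-++⁻ S x (∈-resp-↭ (↭-sym xq↭ay) (here ≈-refl))
  ... | inj₁ a∈x = let x₁ , x↭ax₁ = ∈⇒↭ a∈x in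
    inj₁ (x₁ , x↭ax₁ , (q by drop-∷ (↭-trans (++⁺ʳ q (↭-sym x↭ax₁)) xq↭ay)))
  ... | inj₂ a∈q = let q₁ , q↭aq₁ = ∈⇒↭ a∈q in
    inj₂ (q₁ by drop-∷ (↭-trans (↭-sym (↭-shift x q₁)) (↭-trans (++⁺ˡ x (↭-sym q↭aq₁)) xq↭ay)))

  ∣[]⇒≡[] : ∀ {x} → x ∣ [] → x ≡ []
  ∣[]⇒≡[] {[]} _ = refl
  ∣[]⇒≡[] {_ ∷ _} (q by p) = contradiction p ¬x∷xs↭[]

  ∣-length : ∀ {x y} → x ∣ y → length x ℕ.≤ length y
  ∣-length {x} (q by xq↭y) = ℕ.≤-trans (ℕ.m≤m+n (length x) (length q))
    (ℕ.≤-reflexive (trans (sym (length-++ x)) (xs↭ys⇒|xs|≡|ys| xq↭y)))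

  -- A divisor of `a ∷ y` uses this `a` or does not, which gives two searches through `y`, one of
  -- them for the shifted predicate. Divisors are met only up to permutation, hence the condition on
  -- `P`.
  anyDivisor? : ∀ {p} (P : Pred (List A) p) → P Respects _↭_ → Decidable₁ P →
    ∀ y → Dec (∃[ x ] x ∣ y × P x)
  anyDivisor? P resp P? [] = map′ (λ P[] → [] , ∣-refl , P[])
    (λ { (x , x∣[] , Px) → subst P (∣[]⇒≡[] x∣[]) Px }) (P? [])
  anyDivisor? P resp P? (a ∷ y) = map′
    (λ { (inj₁ (x , x∣y , Pax)) → a ∷ x , ∷⁺-∣ a x∣y , Pax
       ; (inj₂ (x , x∣y , Px))  → x , ∣-∷ʳ a x∣y , Px })
    (λ (x , x∣ay , Px) → cases (∣-∷⁻ x∣ay) Px)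
    (anyDivisor? (P ∘ (a ∷_)) (resp ∘ ↭-prep a) (P? ∘ (a ∷_)) y ⊎-dec anyDivisor? P resp P? y)
    where
    cases : ∀ {x} → (∃[ x₁ ] x ↭ a ∷ x₁ × x₁ ∣ y) ⊎ x ∣ y → P x →
      (∃[ x ] x ∣ y × P (a ∷ x)) ⊎ (∃[ x ] x ∣ y × P x)
    cases (inj₁ (x₁ , x↭ax₁ , x₁∣y)) Px = inj₁ (x₁ , x₁∣y , resp x↭ax₁ Px)
    cases (inj₂ x∣y)                 Px = inj₂ (_ , x∣y , Px)

  open IsGCD

  IsGCD-respˡ : ∀ {g x x₁ y} → x ↭ x₁ → IsGCD g x y → IsGCD g x₁ y
  IsGCD-respˡ x↭x₁ gcd = record
    { divides₁ = ∣-trans (divides₁ gcd) (↭⇒∣ x↭x₁)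
    ; divides₂ = divides₂ gcd
    ; greatest = λ h h∣x₁ → greatest gcd h (∣-trans h∣x₁ (↭⇒∣ (↭-sym x↭x₁))) }

  IsDistance-respˡ : ∀ {x x₁ y n} → x ↭ x₁ → IsDistance x y n → IsDistance x₁ y n
  IsDistance-respˡ x↭x₁ dist = record
    { isGCD = IsGCD-respˡ x↭x₁ isGCD ; x≈gx′ = ↭-trans (↭-sym x↭x₁) x≈gx′ ; y≈gy′ = y≈gy′ ; m≡max = m≡max }
    where open IsDistance dist

  module _ (_≟_ : Decidable _≈_) where

    decSetoid : DecSetoid a ℓ
    decSetoid = record { isDecEquivalence = record { isEquivalence = Setoid.isEquivalence S ; _≟_ = _≟_ } }

    open import Data.List.Membership.DecSetoid decSetoid using (_∈?_)

    infix 4 _↭?_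

    _↭?_ : Decidable _↭_
    []       ↭? []      = yes ↭-refl
    []       ↭? (y ∷ ys) = no (¬x∷xs↭[] ∘ ↭-sym)
    (x ∷ xs) ↭? ys with x ∈? ys
    ... | no x∉ys = no (λ p → x∉ys (∈-resp-↭ p (here ≈-refl)))
    ... | yes x∈ys = let zs , ys↭xzs = ∈⇒↭ x∈ys in
      map′ (λ xs↭zs → ↭-trans (↭-prep x xs↭zs) (↭-sym ys↭xzs))
           (λ xxs↭ys → drop-∷ (↭-trans xxs↭ys ys↭xzs)) (xs ↭? zs)

    gcd : ∀ x y → ∃[ g ] ∃[ x′ ] ∃[ y′ ] x ↭ g ++ x′ × y ↭ g ++ y′ × IsGCD g x y
    gcd [] y = [] , [] , y , ↭-refl , ↭-refl ,
      record { divides₁ = ∣-refl ; divides₂ = []∣ y ; greatest = λ h h∣[] _ → h∣[] }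
    gcd (a ∷ x) y with a ∈? y
    ... | no a∉y = let g , x′ , y′ , x≈ , y≈ , isGCD = gcd x y in
      g , a ∷ x′ , y′ , ↭-trans (↭-prep a x≈) (↭-sym (↭-shift g x′)) , y≈ , record
        { divides₁ = ∣-∷ʳ a (divides₁ isGCD)
        ; divides₂ = divides₂ isGCD
        ; greatest = λ h h∣ax h∣y → greatest′ isGCD h∣y (∣-∷⁻ h∣ax) }
      where
      greatest′ : ∀ {g h} → IsGCD g x y → h ∣ y → (∃[ h₁ ] h ↭ a ∷ h₁ × h₁ ∣ x) ⊎ h ∣ x → h ∣ g
      greatest′ isGCD (q by hq↭y) (inj₁ (_ , h↭ah₁ , _)) = contradiction
        (∈-resp-↭ hq↭y (∈-++⁺ˡ S (∈-resp-↭ (↭-sym h↭ah₁) (here ≈-refl)))) a∉y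
      greatest′ isGCD h∣y (inj₂ h∣x) = greatest isGCD _ h∣x h∣y
    ... | yes a∈y =
      let y₁ , y↭ay₁ = ∈⇒↭ a∈y
          g , x′ , y′ , x≈ , y₁≈ , isGCD = gcd x y₁ in
      a ∷ g , x′ , y′ , ↭-prep a x≈ , ↭-trans y↭ay₁ (↭-prep a y₁≈) , record
        { divides₁ = ∷⁺-∣ a (divides₁ isGCD)
        ; divides₂ = ∣-trans (∷⁺-∣ a (divides₂ isGCD)) (↭⇒∣ (↭-sym y↭ay₁))
        ; greatest = λ h h∣ax h∣y →
            greatest′ isGCD (∣-∷⁻ h∣ax) (∣-∷⁻ (∣-trans h∣y (↭⇒∣ y↭ay₁))) }
      where
      -- A common divisor may use `a` on one side only; it then divides the other side as a whole,
      -- and still does after `a` is removed from it.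
      greatest′ : ∀ {g y₁ h} → IsGCD g x y₁ → (∃[ h₁ ] h ↭ a ∷ h₁ × h₁ ∣ x) ⊎ h ∣ x →
        (∃[ h₁ ] h ↭ a ∷ h₁ × h₁ ∣ y₁) ⊎ h ∣ y₁ → h ∣ a ∷ g
      greatest′ isGCD (inj₁ (h₁ , h↭ , h₁∣x)) (inj₁ (h₂ , h↭′ , h₂∣y)) =
        ∣-trans (↭⇒∣ h↭) (∷⁺-∣ a (greatest isGCD h₁ h₁∣x
          (∣-trans (↭⇒∣ (drop-∷ (↭-trans (↭-sym h↭) h↭′))) h₂∣y)))
      greatest′ isGCD (inj₁ (h₁ , h↭ , h₁∣x)) (inj₂ h∣y) =
        ∣-trans (↭⇒∣ h↭) (∷⁺-∣ a (greatest isGCD h₁ h₁∣x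
          (∣-trans (∣-∷ʳ a ∣-refl) (∣-trans (↭⇒∣ (↭-sym h↭)) h∣y))))
      greatest′ isGCD (inj₂ h∣x) (inj₁ (h₂ , h↭ , h₂∣y)) =
        ∣-trans (↭⇒∣ h↭) (∷⁺-∣ a (greatest isGCD h₂
          (∣-trans (∣-∷ʳ a ∣-refl) (∣-trans (↭⇒∣ (↭-sym h↭)) h∣x)) h₂∣y))
      greatest′ isGCD (inj₂ h∣x) (inj₂ h∣y) = ∣-∷ʳ a (greatest isGCD _ h∣x h∣y)

    distance : ∀ x y → ∃[ n ] IsDistance x y n
    distance x y = let g , x′ , y′ , x≈gx′ , y≈gy′ , isGCD = gcd x y in
      length x′ ℕ.⊔ length y′ , record { isGCD = isGCD ; x≈gx′ = x≈gx′ ; y≈gy′ = y≈gy′ ; m≡max = refl }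

    cofactor-length-≤ : ∀ {x w w′ r r′} → w ∣ w′ → x ↭ w ++ r → x ↭ w′ ++ r′ → length r′ ℕ.≤ length r
    cofactor-length-≤ {x} {w} {w′} {r} {r′} w∣w′ x↭wr x↭w′r′ =
      ℕ.+-cancelˡ-≤ (length w) (length r′) (length r) (begin
        length w ℕ.+ length r′   ≤⟨ ℕ.+-monoˡ-≤ (length r′) (∣-length w∣w′) ⟩
        length w′ ℕ.+ length r′  ≡⟨ length-++ w′ ⟨
        length (w′ ++ r′)        ≡⟨ xs↭ys⇒|xs|≡|ys| (↭-trans (↭-sym x↭w′r′) x↭wr) ⟩
        length (w ++ r)          ≡⟨ length-++ w ⟩
        length w ℕ.+ length r    ∎)
      where open ℕ.≤-Reasoning

    -- An explicit common factor `w` is enough: it divides the gcd, whose cofactors are therefore no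
    -- longer than those of `w`. Distances after an exchange are estimated in this way.
    distance-≤ : ∀ {x y n} → IsDistance x y n → ∀ w {x₁ y₁ m} → x ↭ w ++ x₁ → y ↭ w ++ y₁ →
      length x₁ ℕ.≤ m → length y₁ ℕ.≤ m → n ℕ.≤ m
    distance-≤ {n = n} dist w {x₁} {y₁} {m} x↭wx₁ y↭wy₁ x₁≤m y₁≤m = begin
      n                         ≡⟨ m≡max ⟩
      length x′ ℕ.⊔ length y′   ≤⟨ ℕ.⊔-lub
        (ℕ.≤-trans (cofactor-length-≤ w∣g x↭wx₁ x≈gx′) x₁≤m)
        (ℕ.≤-trans (cofactor-length-≤ w∣g y↭wy₁ y≈gy′) y₁≤m) ⟩
      m ∎
      where
      open IsDistance dist
      open ℕ.≤-Reasoning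
      w∣g = greatest isGCD w (x₁ by ↭-sym x↭wx₁) (y₁ by ↭-sym y↭wy₁)

    distance-unique-≤ : ∀ {x y n n₁} → IsDistance x y n → IsDistance x y n₁ → n ℕ.≤ n₁
    distance-unique-≤ dist dist₁ = distance-≤ dist (g dist₁) (x≈gx′ dist₁) (y≈gy′ dist₁)
      (ℕ.≤-trans (ℕ.m≤m⊔n _ _) (ℕ.≤-reflexive (sym (m≡max dist₁))))
      (ℕ.≤-trans (ℕ.m≤n⊔m (length (x′ dist₁)) _) (ℕ.≤-reflexive (sym (m≡max dist₁))))
      where open IsDistance

    distance≤? : ∀ x y m → Dec (∃[ n ] IsDistance x y n × n ℕ.≤ m)
    distance≤? x y m = let n , dist = distance x y in
      map′ (λ n≤m → n , dist , n≤m)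
        (λ (n₁ , dist₁ , n₁≤m) → ℕ.≤-trans (distance-unique-≤ dist dist₁) n₁≤m) (n ℕ.≤? m)

-- Decidability stands in for classical well-ordering, and the known value `N` bounds the search.
least : ∀ {p} {P : Pred ℕ p} → Decidable₁ P → ∀ N → P N →
  ∃[ m ] P m × m ℕ.≤ N × (∀ m′ → P m′ → m ℕ.≤ m′)
least {P = P} P? N PN = [ (λ (m , m<1+N , Pm , least) → m , Pm , ℕ.s≤s⁻¹ m<1+N , least) ,
                          (λ none → contradiction PN (none N ℕ.≤-refl)) ]′ (search (suc N))
  where
  search : ∀ N → (∃[ m ] m ℕ.< N × P m × (∀ m′ → P m′ → m ℕ.≤ m′)) ⊎ (∀ m → m ℕ.< N → ¬ P m)
  search zero = inj₂ λ _ ()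
  search (suc N) with search N
  ... | inj₁ (m , m<N , rest) = inj₁ (m , ℕ.m<n⇒m<1+n m<N , rest)
  ... | inj₂ none with P? N
  ...   | yes PN = inj₁ (N , ℕ.≤-refl , PN , λ m′ Pm′ → ℕ.≮⇒≥ (λ m′<N → none m′ m′<N Pm′))
  ...   | no ¬PN = inj₂ λ m m<1+N → [ none m , (λ { ≡.refl → ¬PN }) ]′ (ℕ.m≤n⇒m<n∨m≡n (ℕ.s≤s⁻¹ m<1+N))

-- Factorizations over a finite group: decidability of reachability, and the length of atoms.

module Factorizations {c ℓ} (G : AbelianGroup c ℓ) {n : ℕ} (order : HasOrder G n) where

  open AbelianGroup G using (Carrier; _≈_; _∙_; ε; setoid; isCommutativeMonoid)
  private module G = AbelianGroup G
  open ZeroSum G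
  open IsMinimalZeroSum
  module FD = Divisibility setoid
  module ZD = Divisibility atomSetoid
  open FD using (_by_)
  open import Data.List.Relation.Binary.Permutation.Homogeneous using (refl; prep; swap; trans)
  open import Data.List.Relation.Binary.Permutation.Setoid setoid using (↭-refl; ↭-reflexive; ↭-sym; ↭-trans)
  open import Data.List.Relation.Binary.Permutation.Setoid.Properties setoid
    using (++⁺; ++-comm; shifts; xs↭ys⇒|xs|≡|ys|; foldr-commMonoid)
  import Data.List.Relation.Binary.Permutation.Setoid atomSetoid as Z↭
  open Inverse order using (to; to-cong; from-cong; strictlyInverseʳ)

  to-injective : ∀ {x y} → to x ≡ to y → x ≈ y
  to-injective {x} {y} eq = G.trans (G.sym (strictlyInverseʳ x)) (G.trans (from-cong eq) (strictlyInverseʳ y))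

  _≟_ : Decidable _≈_
  x ≟ y = map′ to-injective to-cong (to x Fin.≟ to y)

  infix 4 _↭?_

  _↭?_ : Decidable F._↭_
  _↭?_ = FD._↭?_ _≟_

  _≟ᴬ_ : Decidable (Setoid._≈_ atomSetoid)
  U ≟ᴬ V = proj₁ U ↭? proj₁ V

  σ-resp-↭ : ∀ {S T} → S F.↭ T → σ S ≈ σ T
  σ-resp-↭ = foldr-commMonoid isCommutativeMonoid

  σ-++ : ∀ S T → σ (S ++ T) ≈ σ S ∙ σ T
  σ-++ []      T = G.sym (G.identityˡ (σ T))
  σ-++ (x ∷ S) T = G.trans (G.∙-congˡ (σ-++ S T)) (G.sym (G.assoc x (σ S) (σ T)))

  ≡[]? : Decidable₁ {A = Sequence} (_≡ [])
  ≡[]? []      = yes ≡.refl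
  ≡[]? (_ ∷ _) = no λ ()

  isMinimalZeroSum? : Decidable₁ IsMinimalZeroSum
  isMinimalZeroSum? S = map′
    (λ (ne , zs , min) → record { nonEmpty = ne ; zeroSum = zs ; minimal = min })
    (λ S-min → nonEmpty S-min , zeroSum S-min , minimal S-min)
    (¬? (≡[]? S) ×-dec (σ S ≟ ε) ×-dec ¬? (FD.anyDivisor? _
      (λ {T} {T′} T↭T′ (T≁S , T≢[] , ΣT) →
        (λ T′↭S → T≁S (↭-trans T↭T′ T′↭S)) ,
        (λ { ≡.refl → T≢[] (FD.↭[]⇒≡[] T↭T′) }) ,
        G.trans (σ-resp-↭ (↭-sym T↭T′)) ΣT)
      (λ T → ¬? (T ↭? S) ×-dec ¬? (≡[]? T) ×-dec (σ T ≟ ε)) S))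

  IsMinimalZeroSum-resp-↭ : IsMinimalZeroSum Respects F._↭_
  IsMinimalZeroSum-resp-↭ S↭S′ S-min = record
    { nonEmpty = λ { ≡.refl → nonEmpty S-min (FD.↭[]⇒≡[] S↭S′) }
    ; zeroSum  = G.trans (σ-resp-↭ (↭-sym S↭S′)) (zeroSum S-min)
    ; minimal  = λ (T , T∣S′ , T≁S′ , rest) → minimal S-min
        (T , FD.∣-trans T∣S′ (FD.↭⇒∣ (↭-sym S↭S′)) , (λ T↭S → T≁S′ (↭-trans T↭S S↭S′)) , rest) }

  π-resp-↭ : ∀ {ζ ξ} → ζ Z.↭ ξ → π ζ F.↭ π ξ
  π-resp-↭ (refl pw) = pointwise pw
    where
    pointwise : ∀ {ζ ξ} → Pointwise (Setoid._≈_ atomSetoid) ζ ξ → π ζ F.↭ π ξ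
    pointwise []       = ↭-refl
    pointwise (p ∷ ps) = ++⁺ p (pointwise ps)
  π-resp-↭ (prep p ps)   = ++⁺ p (π-resp-↭ ps)
  π-resp-↭ (swap {x = U} {y = V} p q ps) =
    ↭-trans (shifts (proj₁ U) (proj₁ V)) (++⁺ q (++⁺ p (π-resp-↭ ps)))
  π-resp-↭ (trans p q)   = ↭-trans (π-resp-↭ p) (π-resp-↭ q)

  π-++ : ∀ ζ ξ → π (ζ ++ ξ) ≡ π ζ ++ π ξ
  π-++ []      ξ = ≡.refl
  π-++ (U ∷ ζ) ξ = ≡.trans (cong (proj₁ U ++_) (π-++ ζ ξ)) (≡.sym (++-assoc (proj₁ U) (π ζ) (π ξ)))

  atom-nonEmpty : (U : Atom) → 1 ℕ.≤ length (proj₁ U)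
  atom-nonEmpty ([] , min)    = contradiction ≡.refl (nonEmpty min)
  atom-nonEmpty (_ ∷ _ , min) = ℕ.s≤s ℕ.z≤n

  length≤length-π : ∀ ζ → length ζ ℕ.≤ length (π ζ)
  length≤length-π []      = ℕ.z≤n
  length≤length-π (U ∷ ζ) = subst (suc (length ζ) ℕ.≤_) (≡.sym (length-++ (proj₁ U)))
    (ℕ.+-mono-≤ (atom-nonEmpty U) (length≤length-π ζ))

  ∈L⇒≤ : ∀ {k B} → k ∈L B → k ℕ.≤ length B
  ∈L⇒≤ (ζ , πζ↭B , ≡.refl) = ℕ.≤-trans (length≤length-π ζ) (ℕ.≤-reflexive (xs↭ys⇒|xs|≡|ys| πζ↭B))

  -- Every element of a factorization of B is, up to ↭, one of the finitely many
  -- divisors of B, and the first one may be chosen among these.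
  anyFactorization? : ∀ {p} (B : Sequence) k (P : Pred Factorization p) → P Respects Z._↭_ →
    Decidable₁ P → (∀ {ξ} → P ξ → π ξ F.∣ B) → Dec (∃[ ξ ] length ξ ≡ k × P ξ)
  anyFactorization? B zero P resp P? bound =
    map′ (λ P[] → [] , ≡.refl , P[]) (λ { ([] , _ , P[]) → P[] }) (P? [])
  anyFactorization? B (suc k) P resp P? bound = map′
    (λ (T , _ , min , ξ , len , Pξ) → (T , min) ∷ ξ , cong suc len , Pξ)
    (λ { (U ∷ ξ , len , Pξ) → proj₁ U , FD.∣-trans (π ξ by ↭-refl) (bound Pξ) , proj₂ U , ξ , ℕ.suc-injective len , Pξ })
    (FD.anyDivisor? StartsWith StartsWith-resp StartsWith? B)
    where
    StartsWith : Sequence → Set _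
    StartsWith T = Σ[ min ∈ IsMinimalZeroSum T ] ∃[ ξ ] length ξ ≡ k × P ((T , min) ∷ ξ)
    StartsWith-resp : StartsWith Respects F._↭_
    StartsWith-resp T↭T′ (min , ξ , len , Pξ) =
      IsMinimalZeroSum-resp-↭ T↭T′ min , ξ , len , resp (prep T↭T′ Z↭.↭-refl) Pξ
    StartsWith? : Decidable₁ StartsWith
    StartsWith? T with isMinimalZeroSum? T
    ... | no ¬min = no (¬min ∘ proj₁)
    -- Atoms are compared by their sequences alone, so `P` passes from one proof of minimality to
    -- another.
    ... | yes min = map′ (min ,_) (λ (_ , ξ , len , Pξ) → ξ , len , resp (prep ↭-refl Z↭.↭-refl) Pξ)
      (anyFactorization? B k (P ∘ ((T , min) ∷_)) (resp ∘ prep ↭-refl) (P? ∘ ((T , min) ∷_))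
        (λ {ξ} Pξ → FD.∣-trans (T by ++-comm (π ξ) T) (bound Pξ)))

  _∈L?_ : ∀ k B → Dec (k ∈L B)
  k ∈L? B = map′ (λ (ξ , len , πξ↭B) → ξ , πξ↭B , len) (λ (ξ , πξ↭B , len) → ξ , len , πξ↭B)
    (anyFactorization? B k (λ ξ → π ξ F.↭ B) (λ ζ↭ξ πζ↭B → ↭-trans (π-resp-↭ (Z↭.↭-sym ζ↭ξ)) πζ↭B)
      (λ ξ → π ξ ↭? B) FD.↭⇒∣)

  -- Atoms are non-empty, so every length of `B` is at most `length B`, and the condition on all `j`
  -- becomes a finite check.
  adjacentLengths? : ∀ B k l → Dec (AdjacentLengths B k l)
  adjacentLengths? B k l = map′
    (λ (k∈L , l∈L , k≢l , adj) → record
      { k∈L = k∈L ; l∈L = l∈L ; distinct = k≢l ; adjacent = λ j j∈L → adj (ℕ.s≤s (∈L⇒≤ j∈L)) j∈L })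
    (λ A → let open AdjacentLengths A in k∈L , l∈L , distinct , λ {j} _ → adjacent j)
    ((k ∈L? B) ×-dec (l ∈L? B) ×-dec ¬? (k ℕ.≟ l) ×-dec
      ℕ.allUpTo? (λ j → (j ∈L? B) →-dec
        ¬? (((k ℕ.<? j) ×-dec (j ℕ.<? l)) ⊎-dec ((l ℕ.<? j) ×-dec (j ℕ.<? k)))) (suc (length B)))

  reachesAdjacent? : ∀ ζ m → Dec (ReachesAdjacent ζ m)
  reachesAdjacent? ζ m = map′
    (λ reaches k 1≤k adj → reaches (ℕ.s≤s (∈L⇒≤ (AdjacentLengths.k∈L adj))) 1≤k adj)
    (λ reaches {k} _ → reaches k)
    (ℕ.allUpTo? (λ k → (1 ℕ.≤? k) →-dec (adjacentLengths? (π ζ) k (length ζ) →-dec reach? k)) (suc (length (π ζ))))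
    where
    reach? : ∀ k → Dec (∃[ ξ ] π ξ F.↭ π ζ × length ξ ≡ k × d[ ξ , ζ ]≤ m)
    reach? k = map′ (λ (ξ , len , πξ↭ , d) → ξ , πξ↭ , len , d) (λ (ξ , πξ↭ , len , d) → ξ , len , πξ↭ , d)
      (anyFactorization? (π ζ) k (λ ξ → π ξ F.↭ π ζ × d[ ξ , ζ ]≤ m)
        (λ ξ↭ξ′ (πξ↭ , n , dist , n≤m) →
          ↭-trans (π-resp-↭ (Z↭.↭-sym ξ↭ξ′)) πξ↭ , n , ZD.IsDistance-respˡ ξ↭ξ′ dist , n≤m)
        (λ ξ → (π ξ ↭? π ζ) ×-dec ZD.distance≤? _≟ᴬ_ ξ ζ m) (FD.↭⇒∣ ∘ proj₁))

  -- An upper bound alone does not produce the value δ(ζ); `reachesAdjacent?` allows the least bound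
  -- to be searched for up to `N`.
  successiveDistance≤ : ∀ {N} → (∀ ζ → ReachesAdjacent ζ N) → SuccessiveDistance≤ N
  successiveDistance≤ {N} reaches ζ =
    let m , reach , m≤N , minimal = least (reachesAdjacent? ζ) N (reaches ζ)
    in m , record { reaches = reach ; least = minimal } , m≤N

  σ-cancel : ∀ S T → σ (S ++ T) ≈ σ T → σ S ≈ ε
  σ-cancel S T eq = ∙-cancelʳ (σ T) (σ S) ε (G.trans (G.sym (σ-++ S T)) (G.trans eq (G.sym (G.identityˡ (σ T)))))
    where open import Algebra.Properties.AbelianGroup G using (∙-cancelʳ)

  -- Two of more than n suffixes of S have the same sum; the block between them has sum 0.
  atom-length≤n : (U : Atom) → length (proj₁ U) ℕ.≤ n
  atom-length≤n (S , min) = ℕ.≮⇒≥ λ n<|S| →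
    let k , l , k<l , same = Fin.pigeonhole n<|S| (λ k → to (σ (drop (toℕ k) S)))
        ys , zs , ws , S≡ , zs≢[] , ws≢[] , at-k , at-l = split-at-drops (toℕ k) (toℕ l) S k<l (Fin.toℕ<n l)
        S↭ : zs ++ (ys ++ ws) F.↭ S
        S↭ = ↭-trans (shifts zs ys) (↭-reflexive (≡.sym S≡))
    in minimal min (zs , ((ys ++ ws) by S↭) ,
        (λ zs↭S → ws≢[] (++-conicalʳ ys ws (length≡0 (ys ++ ws) (ℕ.+-cancelˡ-≡ (length zs) _ 0
          (≡.trans (≡.sym (length-++ zs)) (≡.trans (xs↭ys⇒|xs|≡|ys| (↭-trans S↭ (↭-sym zs↭S)))
            (≡.sym (ℕ.+-identityʳ (length zs))))))))) ,
        zs≢[] ,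
        σ-cancel zs ws (subst₂ (λ A B → σ A ≈ σ B) at-k at-l (to-injective same)))
    where
    length≡0 : (T : Sequence) → length T ≡ 0 → T ≡ []
    length≡0 [] _ = ≡.refl

-- Integer differences of naturals, and the size of the box.

≡⇒⊖≡0 : ∀ a b → a ≡ b → a ℤ.⊖ b ≡ ℤ.0ℤ
≡⇒⊖≡0 a .a ≡.refl = ℤ.n⊖n≡0 a

length-pos : ∀ {a} {X : Set a} (xs : List X) → xs ≢ [] → 0 ℕ.< length xs
length-pos []      xs≢[] = contradiction ≡.refl xs≢[]
length-pos (_ ∷ _) _     = ℕ.s≤s ℕ.z≤n

⊖-+-⊖ : ∀ a b c d → (a ℤ.⊖ b) ℤ.+ (c ℤ.⊖ d) ≡ (a ℕ.+ c) ℤ.⊖ (b ℕ.+ d)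
⊖-+-⊖ a b c d = begin
  (a ⊖ b) + (c ⊖ d)            ≡⟨ cong₂ _+_ (m-n≡m⊖n a b) (m-n≡m⊖n c d) ⟨
  (+ a - + b) + (+ c - + d)    ≡⟨ regroup (+ a) (+ b) (+ c) (+ d) ⟩
  (+ a + + c) - (+ b + + d)    ≡⟨ m-n≡m⊖n (a ℕ.+ c) (b ℕ.+ d) ⟩
  (a ℕ.+ c) ⊖ (b ℕ.+ d)        ∎
  where
  open ≡-Reasoning
  open import Data.Integer.Base hiding (suc)
  open import Data.Integer.Properties
  regroup : ∀ a b c d → (a - b) + (c - d) ≡ (a + c) - (b + d)
  regroup = ℤ-Solver.solve-∀

⊖≡0⇒≡ : ∀ a b → a ℤ.⊖ b ≡ ℤ.0ℤ → a ≡ b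
⊖≡0⇒≡ a b eq = ℤ.+-injective (ℤ.i-j≡0⇒i≡j (ℤ.+ a) (ℤ.+ b) (≡.trans (ℤ.m-n≡m⊖n a b) eq))

boxSize≤ : ∀ k → let n = 2 ℕ.+ k in
  suc (2 ℕ.* (suc n ℕ.* n)) ℕ.^ suc n ℕ.≤ (2 ℕ.* n) ℕ.^ (3 ℕ.* n ℕ.+ 1)
boxSize≤ k = begin
  suc (2 ℕ.* (suc n ℕ.* n)) ℕ.^ suc n  ≤⟨ ℕ.^-monoˡ-≤ (suc n) side≤ ⟩
  ((2 ℕ.* n) ℕ.^ 2) ℕ.^ suc n          ≡⟨ ℕ.^-*-assoc (2 ℕ.* n) 2 (suc n) ⟩
  (2 ℕ.* n) ℕ.^ (2 ℕ.* suc n)          ≤⟨ ℕ.^-monoʳ-≤ (2 ℕ.* n) exponent≤ ⟩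
  (2 ℕ.* n) ℕ.^ (3 ℕ.* n ℕ.+ 1)        ∎
  where
  open ℕ.≤-Reasoning
  n = 2 ℕ.+ k
  -- The added polynomial is (2n)^2 minus the side 2n(n + 1) + 1, that is 2n^2 - 2n - 1, at n = 2 +
  -- k. At n = 1 this difference is negative.
  side≡ : ∀ k → suc (2 ℕ.* ((3 ℕ.+ k) ℕ.* (2 ℕ.+ k))) ℕ.+ (2 ℕ.* k ℕ.* k ℕ.+ 6 ℕ.* k ℕ.+ 3)
    ≡ 2 ℕ.* (2 ℕ.+ k) ℕ.* (2 ℕ.* (2 ℕ.+ k) ℕ.* 1)
  side≡ = solve-∀
  side≤ : suc (2 ℕ.* (suc n ℕ.* n)) ℕ.≤ (2 ℕ.* n) ℕ.^ 2
  side≤ = ℕ.≤-trans (ℕ.m≤m+n _ _) (ℕ.≤-reflexive (side≡ k))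
  exponent≡ : ∀ k → 2 ℕ.* (3 ℕ.+ k) ℕ.+ (1 ℕ.+ k) ≡ 3 ℕ.* (2 ℕ.+ k) ℕ.+ 1
  exponent≡ = solve-∀
  exponent≤ : 2 ℕ.* suc n ℕ.≤ 3 ℕ.* n ℕ.+ 1
  exponent≤ = ℕ.≤-trans (ℕ.m≤m+n _ _) (ℕ.≤-reflexive (exponent≡ k))

-- Exchanges between two factorizations as balanced families of vectors.

module Exchange {c ℓ} (G : AbelianGroup c ℓ) {n : ℕ} (order : HasOrder G n) where

  open AbelianGroup G using (_≈_; ε; setoid)
  private module G = AbelianGroup G
  open ZeroSum G
  open Factorizations G order
  open import Data.List.Relation.Binary.Permutation.Homogeneous using (refl; prep; swap; trans)
  open import Data.List.Relation.Binary.Permutation.Setoid setoid using (↭-refl; ↭-sym; ↭-trans; module PermutationReasoning)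
  open import Data.List.Relation.Binary.Permutation.Setoid.Properties setoid
    using (++⁺ʳ; ++-comm; xs↭ys⇒|xs|≡|ys|)
  import Data.List.Relation.Binary.Permutation.Setoid atomSetoid as Z↭
  import Data.List.Relation.Binary.Permutation.Setoid.Properties atomSetoid as Z↭ₚ
  open import Data.List.Membership.Setoid setoid using (_∈_)
  open import Data.List.Relation.Binary.Permutation.Propositional as ↭ using (_↭_)
  import Data.List.Relation.Binary.Permutation.Propositional.Properties as ↭
  open Inverse order using (to; to-cong)

  indicator : ∀ {i j : Fin n} → Dec (i ≡ j) → ℕ
  indicator (yes _) = 1
  indicator (no _)  = 0

  indicator≤1 : ∀ {i j} (i≟j : Dec (i ≡ j)) → indicator i≟j ℕ.≤ 1
  indicator≤1 (yes _) = ℕ.≤-refl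
  indicator≤1 (no _)  = ℕ.z≤n

  count : Fin n → Sequence → ℕ
  count g []      = 0
  count g (x ∷ S) = indicator (to x Fin.≟ g) ℕ.+ count g S

  count-++ : ∀ g S T → count g (S ++ T) ≡ count g S ℕ.+ count g T
  count-++ g []      T = ≡.refl
  count-++ g (x ∷ S) T = ≡.trans (cong (indicator (to x Fin.≟ g) ℕ.+_) (count-++ g S T))
    (≡.sym (ℕ.+-assoc (indicator (to x Fin.≟ g)) (count g S) (count g T)))

  count≤length : ∀ g S → count g S ℕ.≤ length S
  count≤length g []      = ℕ.z≤n
  count≤length g (x ∷ S) = ℕ.+-mono-≤ (indicator≤1 (to x Fin.≟ g)) (count≤length g S)

  count-resp-↭ : ∀ g {S T} → S F.↭ T → count g S ≡ count g T
  count-resp-↭ g (refl pw) = pointwise pw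
    where
    pointwise : ∀ {S T} → Pointwise _≈_ S T → count g S ≡ count g T
    pointwise []         = ≡.refl
    pointwise (x≈y ∷ pw) = cong₂ (λ i k → indicator (i Fin.≟ g) ℕ.+ k) (to-cong x≈y) (pointwise pw)
  count-resp-↭ g (prep x≈y p) = cong₂ (λ i k → indicator (i Fin.≟ g) ℕ.+ k) (to-cong x≈y) (count-resp-↭ g p)
  count-resp-↭ g (swap {x = x} {y} {x′} {y′} x≈x′ y≈y′ p) = ≡.trans
    (cong₂ (λ a b → a ℕ.+ b)
      (cong (λ i → indicator (i Fin.≟ g)) (to-cong x≈x′))
      (cong₂ (λ i k → indicator (i Fin.≟ g) ℕ.+ k) (to-cong y≈y′) (count-resp-↭ g p)))
    (exchange (indicator (to x′ Fin.≟ g)) (indicator (to y′ Fin.≟ g)) _)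
    where
    exchange : ∀ a b c → a ℕ.+ (b ℕ.+ c) ≡ b ℕ.+ (a ℕ.+ c)
    exchange = solve-∀
  count-resp-↭ g (trans p q) = ≡.trans (count-resp-↭ g p) (count-resp-↭ g q)

  count-head : ∀ x S → count (to x) (x ∷ S) ≡ suc (count (to x) S)
  count-head x S with to x Fin.≟ to x
  ... | yes _   = ≡.refl
  ... | no x≢x = contradiction ≡.refl x≢x

  count≢0⇒∈ : ∀ x S → count (to x) S ≢ 0 → x ∈ S
  count≢0⇒∈ x []      c≢0 = contradiction ≡.refl c≢0
  count≢0⇒∈ x (y ∷ S) c≢0 with to y Fin.≟ to x
  ... | yes eq = here (to-injective (≡.sym eq))
  ... | no _   = there (count≢0⇒∈ x S c≢0)

  -- Each head is found in the other list and removed from it. This makes the multiplicity vectors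
  -- faithful: a vanishing sum of vectors gives back equal products.
  counts⇒↭ : ∀ S T → (∀ g → count g S ≡ count g T) → S F.↭ T
  counts⇒↭ []      []      _   = ↭-refl
  counts⇒↭ []      (y ∷ T) eqs = contradiction (≡.trans (eqs (to y)) (count-head y T)) λ ()
  counts⇒↭ (x ∷ S) T       eqs =
    let x∈T = count≢0⇒∈ x T λ c≡0 → contradiction
                (≡.trans (≡.sym (count-head x S)) (≡.trans (eqs (to x)) c≡0)) λ ()
        T′ , T↭xT′ = FD.∈⇒↭ x∈T
    in ↭-trans (prep G.refl (counts⇒↭ S T′ (λ g → ℕ.+-cancelˡ-≡ (indicator (to x Fin.≟ g)) _ _
         (≡.trans (eqs g) (count-resp-↭ g T↭xT′))))) (↭-sym T↭xT′)

  -- A pair x, y of factorizations of the same sequence with |y| = |x| + s is encoded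
  -- by the atoms of x (old), the atoms of y (new) and s gaps; multiplicities and
  -- lengths then give vectors of sum 0.
  data Item : Set (c ⊔ˡ ℓ) where
    old new : Atom → Item
    gap     : Item

  isOld isNew : Item → Maybe Atom
  isOld (old U) = just U
  isOld (new _) = nothing
  isOld gap     = nothing
  isNew (old _) = nothing
  isNew (new V) = just V
  isNew gap     = nothing

  isGap : Item → Maybe ⊤
  isGap (old _) = nothing
  isGap (new _) = nothing
  isGap gap     = just tt

  olds news : List Item → Factorization
  olds = mapMaybe isOld
  news = mapMaybe isNew

  gaps : List Item → ℕ
  gaps xs = length (mapMaybe isGap xs)

  gaps-++ : ∀ xs ys → gaps (xs ++ ys) ≡ gaps xs ℕ.+ gaps ys
  gaps-++ xs ys = ≡.trans (cong length (mapMaybe-++ isGap xs ys)) (length-++ (mapMaybe isGap xs))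

  -- Positive and negative parts of the vector of an item: coordinate `zero` counts factors,
  -- coordinate `suc g` is the multiplicity of `g`. A gap costs one factor, so that balance at
  -- `zero` says that the new atoms outnumber the old ones by the number of gaps.
  gain loss : Item → Fin (suc n) → ℕ
  gain (old _) _       = 0
  gain (new V) zero    = 1
  gain (new V) (suc g) = count g (proj₁ V)
  gain gap     _       = 0
  loss (old U) zero    = 1
  loss (old U) (suc g) = count g (proj₁ U)
  loss (new _) _       = 0
  loss gap     zero    = 1
  loss gap     (suc _) = 0

  1≤n : 1 ℕ.≤ n
  1≤n = ℕ.>-nonZero⁻¹ n ⦃ Fin.nonZeroIndex (to ε) ⦄

  multiplicity≤n : ∀ g (U : Atom) → count g (proj₁ U) ℕ.≤ n
  multiplicity≤n g U = ℕ.≤-trans (count≤length g (proj₁ U)) (atom-length≤n U)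

  gain≤n : ∀ x i → gain x i ℕ.≤ n
  gain≤n (old _) _       = ℕ.z≤n
  gain≤n (new V) zero    = 1≤n
  gain≤n (new V) (suc g) = multiplicity≤n g V
  gain≤n gap     _       = ℕ.z≤n

  loss≤n : ∀ x i → loss x i ℕ.≤ n
  loss≤n (old U) zero    = 1≤n
  loss≤n (old U) (suc g) = multiplicity≤n g U
  loss≤n (new _) _       = ℕ.z≤n
  loss≤n gap     zero    = 1≤n
  loss≤n gap     (suc _) = ℕ.z≤n

  -- With dimension n + 1 and entries at most n the radius is (n + 1) n, and `boxSize` is the left
  -- side of `boxSize≤`.
  open Steinitz (λ x i → gain x i ℤ.⊖ loss x i) n
    (λ x i → ℤ.≤-trans (ℤ.m⊖n≤m (gain x i) (loss x i)) (ℤ.+≤+ (gain≤n x i)))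
    (λ x i → ℤ.≤-trans (ℤ.≤-reflexive (≡.sym (ℤ.⊖-swap (loss x i) (gain x i))))
      (ℤ.≤-trans (ℤ.m⊖n≤m (loss x i) (gain x i)) (ℤ.+≤+ (loss≤n x i))))

  Balanced : List Item → Set
  Balanced xs = ∀ i → vsum xs i ≡ ℤ.0ℤ

  vsum-lengths : ∀ xs → vsum xs zero ≡ length (news xs) ℤ.⊖ (length (olds xs) ℕ.+ gaps xs)
  vsum-lengths []           = ≡.refl
  vsum-lengths (old U ∷ xs) = ≡.trans (cong (ℤ._+_ (0 ℤ.⊖ 1)) (vsum-lengths xs))
    (⊖-+-⊖ 0 1 (length (news xs)) (length (olds xs) ℕ.+ gaps xs))
  vsum-lengths (new V ∷ xs) = ≡.trans (cong (ℤ._+_ (1 ℤ.⊖ 0)) (vsum-lengths xs))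
    (⊖-+-⊖ 1 0 (length (news xs)) (length (olds xs) ℕ.+ gaps xs))
  vsum-lengths (gap ∷ xs)   = ≡.trans (cong (ℤ._+_ (0 ℤ.⊖ 1)) (vsum-lengths xs))
    (≡.trans (⊖-+-⊖ 0 1 (length (news xs)) (length (olds xs) ℕ.+ gaps xs))
      (cong (length (news xs) ℤ.⊖_) (≡.sym (ℕ.+-suc (length (olds xs)) (gaps xs)))))

  vsum-counts : ∀ xs g → vsum xs (suc g) ≡ count g (π (news xs)) ℤ.⊖ count g (π (olds xs))
  vsum-counts []           g = ≡.refl
  vsum-counts (old U ∷ xs) g = ≡.trans (cong (ℤ._+_ (0 ℤ.⊖ count g (proj₁ U))) (vsum-counts xs g))
    (≡.trans (⊖-+-⊖ 0 (count g (proj₁ U)) (count g (π (news xs))) (count g (π (olds xs))))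
      (cong (count g (π (news xs)) ℤ.⊖_) (≡.sym (count-++ g (proj₁ U) (π (olds xs))))))
  vsum-counts (new V ∷ xs) g = ≡.trans (cong (ℤ._+_ (count g (proj₁ V) ℤ.⊖ 0)) (vsum-counts xs g))
    (≡.trans (⊖-+-⊖ (count g (proj₁ V)) 0 (count g (π (news xs))) (count g (π (olds xs))))
      (cong (ℤ._⊖ count g (π (olds xs))) (≡.sym (count-++ g (proj₁ V) (π (news xs))))))
  vsum-counts (gap ∷ xs)   g = ≡.trans (ℤ.+-identityˡ (vsum xs (suc g))) (vsum-counts xs g)

  balanced⁺ : ∀ xs → π (olds xs) F.↭ π (news xs) → length (news xs) ≡ length (olds xs) ℕ.+ gaps xs →
    Balanced xs
  balanced⁺ xs πo↭πn len zero = ≡.trans (vsum-lengths xs)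
    (≡⇒⊖≡0 (length (news xs)) (length (olds xs) ℕ.+ gaps xs) len)
  balanced⁺ xs πo↭πn len (suc g) = ≡.trans (vsum-counts xs g)
    (≡⇒⊖≡0 (count g (π (news xs))) (count g (π (olds xs))) (≡.sym (count-resp-↭ g πo↭πn)))

  balanced⇒π : ∀ xs → Balanced xs → π (olds xs) F.↭ π (news xs)
  balanced⇒π xs balanced = counts⇒↭ (π (olds xs)) (π (news xs)) (λ g → ≡.sym
    (⊖≡0⇒≡ (count g (π (news xs))) (count g (π (olds xs))) (≡.trans (≡.sym (vsum-counts xs g)) (balanced (suc g)))))

  balanced⇒length : ∀ xs → Balanced xs → length (news xs) ≡ length (olds xs) ℕ.+ gaps xs
  balanced⇒length xs balanced = ⊖≡0⇒≡ (length (news xs)) (length (olds xs) ℕ.+ gaps xs)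
    (≡.trans (≡.sym (vsum-lengths xs)) (balanced zero))

  -- It can be used in both directions: putting `y₁` for `x₁` in `x` adds `j` factors, putting `x₁`
  -- for `y₁` in `y` removes `j`. One record thus serves adjacent lengths above and below.
  record SubExchange (x y : Factorization) (j : ℕ) : Set (c ⊔ˡ ℓ) where
    field
      x₁ x₂ y₁ y₂ : Factorization
      x↭   : x Z.↭ x₁ ++ x₂
      y↭   : y Z.↭ y₁ ++ y₂
      π₁↭  : π x₁ F.↭ π y₁
      len  : length y₁ ≡ length x₁ ℕ.+ j

  subExchange : ∀ {xs} ys zs → xs ↭ ys ++ zs → Balanced ys → SubExchange (olds xs) (news xs) (gaps ys)
  subExchange {xs} ys zs p balanced = record
    { x₁ = olds ys ; x₂ = olds zs ; y₁ = news ys ; y₂ = news zs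
    ; x↭ = restrict isOld ; y↭ = restrict isNew
    ; π₁↭ = balanced⇒π ys balanced ; len = balanced⇒length ys balanced }
    where
    restrict : ∀ f → mapMaybe f xs Z.↭ mapMaybe f ys ++ mapMaybe f zs
    restrict f = ↭.↭⇒↭ₛ′ (Setoid.isEquivalence atomSetoid)
      (subst (mapMaybe f xs ↭_) (mapMaybe-++ f ys zs) (↭.mapMaybe-↭ f p))

  Block : List Item → ℕ → ℕ → Set (c ⊔ˡ ℓ)
  Block xs s N = ∃[ ys ] ∃[ zs ] xs ↭ ys ++ zs × Balanced ys × gaps ys ≡ s × length ys ℕ.≤ N

  module _ (N : ℕ) (splits : ∀ xs → Balanced xs → N ℕ.< length xs → SplitsIntoZeroSums xs)
    (xs : List Item) (s : ℕ)
    (none-between : ∀ j → SubExchange (olds xs) (news xs) j → 0 ℕ.< j → ¬ j ℕ.< s) where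

    -- As no length lies strictly between, one of the two parts keeps all the gaps.
    one-keeps-gaps : ∀ {ys zs} as bs → xs ↭ ys ++ zs → ys ↭ as ++ bs → Balanced as → gaps ys ≡ s →
      gaps as ≡ s ⊎ gaps bs ≡ s
    one-keeps-gaps {ys} {zs} as bs p q balanced gaps≡s = [ inj₂ ∘ from-zero , inj₁ ]′ extreme
      where
      total : gaps as ℕ.+ gaps bs ≡ s
      total = ≡.trans (≡.sym (gaps-++ as bs)) (≡.trans (≡.sym (↭.↭-length (↭.mapMaybe-↭ isGap q))) gaps≡s)
      sub : SubExchange (olds xs) (news xs) (gaps as)
      sub = subExchange as (bs ++ zs)
        (↭.↭-trans p (↭.↭-trans (↭.++⁺ʳ zs q) (↭.↭-reflexive (++-assoc as bs zs)))) balanced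
      as≤s : gaps as ℕ.≤ s
      as≤s = subst (gaps as ℕ.≤_) total (ℕ.m≤m+n (gaps as) (gaps bs))
      extreme : gaps as ≡ 0 ⊎ gaps as ≡ s
      extreme = [ (λ as<s → inj₁ (ℕ.n≤0⇒n≡0 (ℕ.≮⇒≥ λ 0<as → none-between (gaps as) sub 0<as as<s))) , inj₂ ]′
        (ℕ.m≤n⇒m<n∨m≡n as≤s)
      from-zero : gaps as ≡ 0 → gaps bs ≡ s
      from-zero as≡0 = ≡.trans (cong (ℕ._+ gaps bs) (≡.sym as≡0)) total

    -- The discarded part moves into `zs`, so what is kept is still a part of the original `xs` and
    -- `none-between` stays applicable. Both parts of a split are non-empty, hence the length
    -- descends.
    small-block : ∀ ys zs → Acc ℕ._<_ (length ys) → xs ↭ ys ++ zs → Balanced ys → gaps ys ≡ s →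
      Block xs s N
    small-block ys zs (acc rec) p balanced gaps≡s =
      [ (λ small → ys , zs , p , balanced , gaps≡s , small) , (λ large → descend (splits ys balanced large)) ]′
        (ℕ.≤-<-connex (length ys) N)
      where
      descend : SplitsIntoZeroSums ys → Block xs s N
      descend (as , bs , q , as≢[] , bs≢[] , Σas , Σbs) =
        [ small-block as (bs ++ zs) (rec as-shorter) p-as Σas ,
          small-block bs (as ++ zs) (rec bs-shorter) (↭.↭-trans p-as (↭.shifts as bs)) Σbs ]′
          (one-keeps-gaps as bs p q Σas gaps≡s)
        where
        p-as : xs ↭ as ++ (bs ++ zs)
        p-as = ↭.↭-trans p (↭.↭-trans (↭.++⁺ʳ zs q) (↭.↭-reflexive (++-assoc as bs zs)))
        |ys|≡ : length ys ≡ length as ℕ.+ length bs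
        |ys|≡ = ≡.trans (↭.↭-length q) (length-++ as)
        as-shorter : length as ℕ.< length ys
        as-shorter = subst (length as ℕ.<_) (≡.sym |ys|≡) (ℕ.m<m+n (length as) (length-pos bs bs≢[]))
        bs-shorter : length bs ℕ.< length ys
        bs-shorter = subst (length bs ℕ.<_) (≡.sym |ys|≡) (ℕ.m<n+m (length bs) (length-pos as as≢[]))

  open SubExchange

  small-subExchange : ∀ {xs s N} → Block xs s N →
    Σ[ E ∈ SubExchange (olds xs) (news xs) s ] length (x₁ E) ℕ.≤ N × length (y₁ E) ℕ.≤ N
  small-subExchange (ys , zs , p , balanced , ≡.refl , small) = subExchange ys zs p balanced ,
    ℕ.≤-trans (length-mapMaybe isOld ys) small , ℕ.≤-trans (length-mapMaybe isNew ys) small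

  small-exchange : ∀ x y s → π x F.↭ π y → length y ≡ length x ℕ.+ s →
    (∀ j → SubExchange x y j → 0 ℕ.< j → ¬ j ℕ.< s) →
    Σ[ E ∈ SubExchange x y s ] length (x₁ E) ℕ.≤ boxSize × length (y₁ E) ℕ.≤ boxSize
  small-exchange x y s πx↭πy len none-between =
    -- The items give back `x` and `y` only up to propositional equality, hence the transports.
    subst₂ (λ x′ y′ → Σ[ E ∈ SubExchange x′ y′ s ] length (x₁ E) ℕ.≤ boxSize × length (y₁ E) ℕ.≤ boxSize)
      olds≡x news≡y
      (small-subExchange (small-block boxSize zero-sum-splits items s
        (subst₂ (λ x′ y′ → ∀ j → SubExchange x′ y′ j → 0 ℕ.< j → ¬ j ℕ.< s)
          (≡.sym olds≡x) (≡.sym news≡y) none-between)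
        items [] (<-wellFounded (length items)) (↭.↭-reflexive (≡.sym (++-identityʳ items)))
        (balanced⁺ items
          (subst₂ (λ x y → π x F.↭ π y) (≡.sym olds≡x) (≡.sym news≡y) πx↭πy)
          (≡.trans (cong length news≡y) (≡.trans len (≡.sym (cong₂ ℕ._+_ (cong length olds≡x) gaps≡)))))
        gaps≡))
    where
    -- Written as a `map` so that the same lemmas on `mapMaybe` of a `map` treat atoms and gaps.
    gapped = map (λ (_ : ⊤) → gap) (replicate s tt)
    items = map old x ++ map new y ++ gapped
    parts : ∀ {b} {B : Set b} (f : Item → Maybe B) →
      mapMaybe f items ≡ mapMaybe f (map old x) ++ mapMaybe f (map new y) ++ mapMaybe f gapped
    parts f = ≡.trans (mapMaybe-++ f (map old x) (map new y ++ gapped))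
      (cong (mapMaybe f (map old x) ++_) (mapMaybe-++ f (map new y) gapped))
    olds≡x : olds items ≡ x
    olds≡x = ≡.trans (parts isOld) (≡.trans
      (cong₂ _++_ (mapMaybe-map-retract (λ _ → ≡.refl) x)
        (cong₂ _++_ (mapMaybe-map-none (λ _ → ≡.refl) y) (mapMaybe-map-none (λ _ → ≡.refl) (replicate s tt))))
      (++-identityʳ x))
    news≡y : news items ≡ y
    news≡y = ≡.trans (parts isNew) (≡.trans
      (cong₂ _++_ (mapMaybe-map-none (λ _ → ≡.refl) x)
        (cong₂ _++_ (mapMaybe-map-retract (λ _ → ≡.refl) y) (mapMaybe-map-none (λ _ → ≡.refl) (replicate s tt))))
      (++-identityʳ y))
    gaps≡ : gaps items ≡ s
    gaps≡ = ≡.trans (cong length (≡.trans (parts isGap)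
      (cong₂ _++_ (mapMaybe-map-none (λ _ → ≡.refl) x)
        (cong₂ _++_ (mapMaybe-map-none (λ _ → ≡.refl) y) (mapMaybe-map-retract (λ _ → ≡.refl) (replicate s tt))))))
      (length-replicate s)

  -- Applying an exchange to a factorization.

  replace-π : ∀ z a b a′ → z Z.↭ a ++ b → π a F.↭ π a′ → π (b ++ a′) F.↭ π z
  replace-π z a b a′ z↭ab πa↭πa′ = begin
    π (b ++ a′)  ≡⟨ π-++ b a′ ⟩
    π b ++ π a′  ↭⟨ ++-comm (π b) (π a′) ⟩
    π a′ ++ π b  ↭⟨ ++⁺ʳ (π b) πa↭πa′ ⟨
    π a ++ π b   ≡⟨ π-++ a b ⟨
    π (a ++ b)   ↭⟨ π-resp-↭ z↭ab ⟨
    π z          ∎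
    where open PermutationReasoning

  replace-length : ∀ z a b a′ → z Z.↭ a ++ b → length (b ++ a′) ℕ.+ length a ≡ length z ℕ.+ length a′
  replace-length z a b a′ z↭ab = begin
    length (b ++ a′) ℕ.+ length a        ≡⟨ cong (ℕ._+ length a) (length-++ b) ⟩
    length b ℕ.+ length a′ ℕ.+ length a  ≡⟨ rotate (length a) (length b) (length a′) ⟩
    length a ℕ.+ length b ℕ.+ length a′  ≡⟨ cong (ℕ._+ length a′) (length-++ a) ⟨
    length (a ++ b) ℕ.+ length a′        ≡⟨ cong (ℕ._+ length a′) (Z↭ₚ.xs↭ys⇒|xs|≡|ys| z↭ab) ⟨
    length z ℕ.+ length a′               ∎
    where
    open ≡-Reasoning
    rotate : ∀ a b a′ → b ℕ.+ a′ ℕ.+ a ≡ a ℕ.+ b ℕ.+ a′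
    rotate = solve-∀

  -- The untouched part `b` is a common factor with cofactors `a′` and `a`, as `distance-≤`
  -- requires.
  replace-distance : ∀ z a b a′ {m} → z Z.↭ a ++ b → length a ℕ.≤ m → length a′ ℕ.≤ m →
    d[ b ++ a′ , z ]≤ m
  replace-distance z a b a′ z↭ab a≤m a′≤m =
    let n , dist = ZD.distance _≟ᴬ_ (b ++ a′) z in
    n , dist , ZD.distance-≤ _≟ᴬ_ dist b Z↭.↭-refl (Z↭.↭-trans z↭ab (Z↭ₚ.++-comm a b)) a′≤m a≤m

  lengthen shorten : ∀ {x y j} → SubExchange x y j → Factorization
  lengthen E = x₂ E ++ y₁ E
  shorten  E = y₂ E ++ x₁ E

  lengthen-π : ∀ {x y j} (E : SubExchange x y j) → π (lengthen E) F.↭ π x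
  lengthen-π {x} E = replace-π x (x₁ E) (x₂ E) (y₁ E) (x↭ E) (π₁↭ E)

  shorten-π : ∀ {x y j} (E : SubExchange x y j) → π (shorten E) F.↭ π y
  shorten-π {y = y} E = replace-π y (y₁ E) (y₂ E) (x₁ E) (y↭ E) (↭-sym (π₁↭ E))

  lengthen-length : ∀ {x y j} (E : SubExchange x y j) → length (lengthen E) ≡ length x ℕ.+ j
  lengthen-length {x} {j = j} E = ℕ.+-cancelʳ-≡ (length (x₁ E)) _ _ (begin
    length (lengthen E) ℕ.+ length (x₁ E)  ≡⟨ replace-length x (x₁ E) (x₂ E) (y₁ E) (x↭ E) ⟩
    length x ℕ.+ length (y₁ E)             ≡⟨ cong (length x ℕ.+_) (len E) ⟩
    length x ℕ.+ (length (x₁ E) ℕ.+ j)     ≡⟨ rotate (length x) (length (x₁ E)) j ⟩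
    length x ℕ.+ j ℕ.+ length (x₁ E)       ∎)
    where
    open ≡-Reasoning
    rotate : ∀ a b c → a ℕ.+ (b ℕ.+ c) ≡ a ℕ.+ c ℕ.+ b
    rotate = solve-∀

  shorten-length : ∀ {x y j} (E : SubExchange x y j) → length (shorten E) ℕ.+ j ≡ length y
  shorten-length {y = y} {j} E = ℕ.+-cancelʳ-≡ (length (x₁ E)) _ _ (begin
    length (shorten E) ℕ.+ j ℕ.+ length (x₁ E)    ≡⟨ rotate (length (shorten E)) (length (x₁ E)) j ⟨
    length (shorten E) ℕ.+ (length (x₁ E) ℕ.+ j)  ≡⟨ cong (length (shorten E) ℕ.+_) (len E) ⟨
    length (shorten E) ℕ.+ length (y₁ E)          ≡⟨ replace-length y (y₁ E) (y₂ E) (x₁ E) (y↭ E) ⟩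
    length y ℕ.+ length (x₁ E)                    ∎)
    where
    open ≡-Reasoning
    rotate : ∀ a b c → a ℕ.+ (b ℕ.+ c) ≡ a ℕ.+ c ℕ.+ b
    rotate = solve-∀

  reaches-longer : ∀ ζ ξ → π ξ F.↭ π ζ → length ζ ℕ.< length ξ →
    (∀ j → j ∈L π ζ → length ζ ℕ.< j → ¬ j ℕ.< length ξ) →
    ∃[ ξ′ ] π ξ′ F.↭ π ζ × length ξ′ ≡ length ξ × d[ ξ′ , ζ ]≤ boxSize
  reaches-longer ζ ξ πξ↭πζ |ζ|<|ξ| none-between =
    conclude (small-exchange ζ ξ s (↭-sym πξ↭πζ) (≡.sym |ζ|+s)
      -- A sub-exchange with 0 < j < s, applied to `ζ`, would realise a length strictly between.
      (λ j E 0<j j<s → none-between (length ζ ℕ.+ j) (lengthen E , lengthen-π E , lengthen-length E)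
        (ℕ.m<m+n (length ζ) 0<j) (subst (length ζ ℕ.+ j ℕ.<_) |ζ|+s (ℕ.+-monoʳ-< (length ζ) j<s))))
    where
    s = length ξ ℕ.∸ length ζ
    |ζ|+s : length ζ ℕ.+ s ≡ length ξ
    |ζ|+s = ℕ.m+[n∸m]≡n (ℕ.<⇒≤ |ζ|<|ξ|)
    conclude : ∀ {N} → Σ[ E ∈ SubExchange ζ ξ s ] length (x₁ E) ℕ.≤ N × length (y₁ E) ℕ.≤ N →
      ∃[ ξ′ ] π ξ′ F.↭ π ζ × length ξ′ ≡ length ξ × d[ ξ′ , ζ ]≤ N
    conclude (E , x₁≤N , y₁≤N) = lengthen E , lengthen-π E , ≡.trans (lengthen-length E) |ζ|+s ,
      replace-distance ζ (x₁ E) (x₂ E) (y₁ E) (x↭ E) x₁≤N y₁≤N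

  -- Here `ζ` is the longer side, so the exchange from `ξ` to `ζ` is applied backwards inside `ζ`;
  -- one with 0 < j < s would realise the length |ζ| - j.
  reaches-shorter : ∀ ζ ξ → π ξ F.↭ π ζ → length ξ ℕ.< length ζ →
    (∀ j → j ∈L π ζ → length ξ ℕ.< j → ¬ j ℕ.< length ζ) →
    ∃[ ξ′ ] π ξ′ F.↭ π ζ × length ξ′ ≡ length ξ × d[ ξ′ , ζ ]≤ boxSize
  reaches-shorter ζ ξ πξ↭πζ |ξ|<|ζ| none-between =
    conclude (small-exchange ξ ζ s πξ↭πζ (≡.sym |ξ|+s)
      (λ j E 0<j j<s → none-between (length (shorten E)) (shorten E , shorten-π E , ≡.refl)
        (ℕ.+-cancelʳ-< j (length ξ) (length (shorten E)) (subst (length ξ ℕ.+ j ℕ.<_)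
          (≡.trans |ξ|+s (≡.sym (shorten-length E))) (ℕ.+-monoʳ-< (length ξ) j<s)))
        (subst (length (shorten E) ℕ.<_) (shorten-length E) (ℕ.m<m+n (length (shorten E)) 0<j))))
    where
    s = length ζ ℕ.∸ length ξ
    |ξ|+s : length ξ ℕ.+ s ≡ length ζ
    |ξ|+s = ℕ.m+[n∸m]≡n (ℕ.<⇒≤ |ξ|<|ζ|)
    conclude : ∀ {N} → Σ[ E ∈ SubExchange ξ ζ s ] length (x₁ E) ℕ.≤ N × length (y₁ E) ℕ.≤ N →
      ∃[ ξ′ ] π ξ′ F.↭ π ζ × length ξ′ ≡ length ξ × d[ ξ′ , ζ ]≤ N
    conclude (E , x₁≤N , y₁≤N) = shorten E , shorten-π E ,
      ℕ.+-cancelʳ-≡ s (length (shorten E)) (length ξ) (≡.trans (shorten-length E) (≡.sym |ξ|+s)) ,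
      replace-distance ζ (y₁ E) (y₂ E) (x₁ E) (y↭ E) y₁≤N x₁≤N

  reaches-boxSize : ∀ ζ → ReachesAdjacent ζ boxSize
  reaches-boxSize ζ k _ adj with AdjacentLengths.k∈L adj
  ... | ξ , πξ↭πζ , ≡.refl with ℕ.<-cmp (length ξ) (length ζ)
  ...   | tri≈ _ |ξ|≡|ζ| _ = contradiction |ξ|≡|ζ| (AdjacentLengths.distinct adj)
  ...   | tri> _ _ |ζ|<|ξ| = reaches-longer ζ ξ πξ↭πζ |ζ|<|ξ|
    (λ j j∈L |ζ|<j j<|ξ| → AdjacentLengths.adjacent adj j j∈L (inj₂ (|ζ|<j , j<|ξ|)))
  ...   | tri< |ξ|<|ζ| _ _ = reaches-shorter ζ ξ πξ↭πζ |ξ|<|ζ|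
    (λ j j∈L |ξ|<j j<|ζ| → AdjacentLengths.adjacent adj j j∈L (inj₁ (|ξ|<j , j<|ζ|)))

  -- Every atom has length exactly 1, so the number of factors is the length of the sequence and
  -- there are no two distinct lengths.
  reaches-trivial : n ≡ 1 → ∀ ζ m → ReachesAdjacent ζ m
  reaches-trivial n≡1 ζ m k _ adj with AdjacentLengths.k∈L adj
  ... | ξ , πξ↭πζ , ≡.refl = contradiction
      (≡.trans (≡.sym (length-π ξ)) (≡.trans (xs↭ys⇒|xs|≡|ys| πξ↭πζ) (length-π ζ)))
      (AdjacentLengths.distinct adj)
    where
    length-π : ∀ ζ → length (π ζ) ≡ length ζ
    length-π []      = ≡.refl
    length-π (U ∷ ζ) = ≡.trans (length-++ (proj₁ U)) (cong₂ ℕ._+_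
      (ℕ.≤-antisym (subst (length (proj₁ U) ℕ.≤_) n≡1 (atom-length≤n U)) (atom-nonEmpty U)) (length-π ζ))

  reaches : ∀ ζ → ReachesAdjacent ζ ((2 ℕ.* n) ℕ.^ (3 ℕ.* n ℕ.+ 1))
  reaches ζ = go n ≡.refl
    where
    -- The module fixes `n`, so the cases are made on a copy `m`. The value 0 is impossible because
    -- `ε` has an index in `Fin n`.
    go : ∀ m → n ≡ m → ReachesAdjacent ζ ((2 ℕ.* n) ℕ.^ (3 ℕ.* n ℕ.+ 1))
    go 0 n≡0 = contradiction (subst (1 ℕ.≤_) n≡0 1≤n) λ ()
    go 1 n≡1 = reaches-trivial n≡1 ζ _
    go (suc (suc k)) n≡2+k l 1≤l adj =
      let ξ , πξ↭ , len , m , dist , m≤ = reaches-boxSize ζ l 1≤l adj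
      in ξ , πξ↭ , len , m , dist , ℕ.≤-trans m≤
           (subst (λ n → suc (2 ℕ.* (suc n ℕ.* n)) ℕ.^ suc n ℕ.≤ (2 ℕ.* n) ℕ.^ (3 ℕ.* n ℕ.+ 1))
             (≡.sym n≡2+k) (boxSize≤ k))

open import Data.Nat.Base using (_+_; _*_; _^_)

theorem6p5 : ∀ {c ℓ : Level} (G : AbelianGroup c ℓ) (n : ℕ) → HasOrder G n →
    ZeroSum.SuccessiveDistance≤ G ((2 * n) ^ (3 * n + 1))
theorem6p5 G n order = Factorizations.successiveDistance≤ G order (Exchange.reaches G order)
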